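{- Let $k\ge2$ be an integer, let $X_1,\dots,X_k,L\in[1,\infty)$ with $L\ge\max(X_1,\dots,X_k)$, and let $\delta\in(0,1]$. Let $A_i\subset[X_i,2X_i]$ ($1\le i\le k$) be sets of integers such that $\operatorname{lcm}(a_1,\dots,a_k)\le L$ for at least $\delta\prod_{i=1}^k|A_i|$ tuples $(a_1,\dots,a_k)\in\prod_{i=1}^kA_i$. Then for every fixed $\varepsilon\in(0,1)$, $$\prod_{i=1}^k|A_i|\ll_{k,\varepsilon}\delta^{ -\frac{k}{k-1}}\,\frac{L^{\frac{k}{k-1}+\varepsilon}}{\left(\prod_{i=1}^kX_i\right)^{\frac1{k-1}}},$$ where the implied constant depends only on $k$ and $\varepsilon$. -}

module Defs where

open import Data.Empty using (⊥-elim)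
open import Data.Fin using (Fin)
open import Data.Integer as ℤ using (ℤ; +_; -[1+_])
import Data.Integer.LCM as ℤ
import Data.Integer.Properties as ℤ
open import Data.List using (List; length)
import Data.List.Membership.Propositional as List
open import Data.List.Relation.Unary.Unique.Propositional using (Unique)
open import Data.Nat as ℕ using (ℕ; zero; suc; NonTrivial)
open import Data.Nat.Coprimality using (Coprime)
import Data.Nat.Properties as ℕ
open import Data.Product using (∃; _×_; _,_; proj₁; proj₂)
open import Data.Rational as ℚ using (ℚ; mkℚ; 0ℚ; 1ℚ; ↥_)
import Data.Rational.Properties as ℚ
open import Data.Sum using (inj₁; inj₂)
open import Data.Vec using (Vec)
import Data.Vec as Vec
import Data.Vec.Functional as F
open import Algebra.Definitions.RawSemiring ℚ.+-*-rawSemiring using () renaming (_^_ to _^ℚ_)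
open import Relation.Binary.PropositionalEquality
  using (_≡_; refl; sym; trans; cong; subst; subst₂)
open import Relation.Nullary using (yes; no)

private
  variable
    p q r u v : ℚ

  0<1 : 0ℚ ℚ.< 1ℚ
  0<1 = ℚ.positive⁻¹ 1ℚ

  0≤1 : 0ℚ ℚ.≤ 1ℚ
  0≤1 = ℚ.<⇒≤ 0<1

  <⇒≱ : p ℚ.< q → q ℚ.≰ p
  <⇒≱ p<q q≤p = ℚ.<-irrefl refl (ℚ.<-≤-trans p<q q≤p)

  p-1<p : ∀ p → p ℚ.- 1ℚ ℚ.< p
  p-1<p p = subst (p ℚ.- 1ℚ ℚ.<_) (ℚ.+-identityʳ p) (ℚ.+-monoʳ-< p (ℚ.negative⁻¹ (ℚ.- 1ℚ)))

  <-⊓ : r ℚ.< p → r ℚ.< q → r ℚ.< p ℚ.⊓ q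
  <-⊓ {r} {p} {q} r<p r<q with ℚ.⊓-sel p q
  ... | inj₁ eq = subst (r ℚ.<_) (sym eq) r<p
  ... | inj₂ eq = subst (r ℚ.<_) (sym eq) r<q

  *-mono-≤ : 0ℚ ℚ.≤ p → p ℚ.≤ q → 0ℚ ℚ.≤ u → u ℚ.≤ v → p ℚ.* u ℚ.≤ q ℚ.* v
  *-mono-≤ {p} {q} {u} {v} 0≤p p≤q 0≤u u≤v = ℚ.≤-trans
    (ℚ.*-monoʳ-≤-nonNeg u {{ℚ.nonNegative 0≤u}} p≤q)
    (ℚ.*-monoˡ-≤-nonNeg q {{ℚ.nonNegative (ℚ.≤-trans 0≤p p≤q)}} u≤v)

  *-pos : 0ℚ ℚ.< p → 0ℚ ℚ.< q → 0ℚ ℚ.< p ℚ.* q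
  *-pos {p} {q} 0<p 0<q = ℚ.positive⁻¹ (p ℚ.* q)
    {{ℚ.pos*pos⇒pos p {{ℚ.positive 0<p}} q {{ℚ.positive 0<q}}}}

  *-nonNeg : 0ℚ ℚ.≤ p → 0ℚ ℚ.≤ q → 0ℚ ℚ.≤ p ℚ.* q
  *-nonNeg {p} {q} 0≤p 0≤q = ℚ.nonNegative⁻¹ (p ℚ.* q)
    {{ℚ.nonNeg*nonNeg⇒nonNeg p {{ℚ.nonNegative 0≤p}} q {{ℚ.nonNegative 0≤q}}}}

  1<* : 1ℚ ℚ.< p → 1ℚ ℚ.< q → 1ℚ ℚ.< p ℚ.* q
  1<* {p} {q} 1<p 1<q = ℚ.<-trans 1<p
    (subst (ℚ._< p ℚ.* q) (ℚ.*-identityʳ p)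
      (ℚ.*-monoʳ-<-pos p {{ℚ.positive (ℚ.<-trans 0<1 1<p)}} 1<q))

  ^-nonNeg : ∀ n → 0ℚ ℚ.≤ p → 0ℚ ℚ.≤ p ^ℚ n
  ^-nonNeg zero    0≤p = 0≤1
  ^-nonNeg (suc n) 0≤p = *-nonNeg 0≤p (^-nonNeg n 0≤p)

  ^-pos : ∀ n → 0ℚ ℚ.< p → 0ℚ ℚ.< p ^ℚ n
  ^-pos zero    0<p = 0<1
  ^-pos (suc n) 0<p = *-pos 0<p (^-pos n 0<p)

  ^-mono : ∀ n → 0ℚ ℚ.≤ p → p ℚ.≤ q → p ^ℚ n ℚ.≤ q ^ℚ n
  ^-mono zero    0≤p p≤q = ℚ.≤-refl
  ^-mono (suc n) 0≤p p≤q = *-mono-≤ 0≤p p≤q (^-nonNeg n 0≤p) (^-mono n 0≤p p≤q)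

  ^-mono-< : ∀ n → 0ℚ ℚ.≤ p → p ℚ.< q → p ^ℚ suc n ℚ.< q ^ℚ suc n
  ^-mono-< {p} {q} n 0≤p p<q = ℚ.≤-<-trans
    (ℚ.*-monoˡ-≤-nonNeg p {{ℚ.nonNegative 0≤p}} (^-mono n 0≤p (ℚ.<⇒≤ p<q)))
    (ℚ.*-monoˡ-<-pos (q ^ℚ n) {{ℚ.positive (^-pos n (ℚ.≤-<-trans 0≤p p<q))}} p<q)

  1^ : ∀ n → 1ℚ ^ℚ n ≡ 1ℚ
  1^ zero    = refl
  1^ (suc n) = trans (ℚ.*-identityˡ _) (1^ n)

  1≤^ : ∀ n → 1ℚ ℚ.≤ p → 1ℚ ℚ.≤ p ^ℚ n
  1≤^ {p} n 1≤p = subst (ℚ._≤ p ^ℚ n) (1^ n) (^-mono n 0≤1 1≤p)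

  ^≤1 : ∀ n → 0ℚ ℚ.≤ p → p ℚ.≤ 1ℚ → p ^ℚ n ℚ.≤ 1ℚ
  ^≤1 {p} n 0≤p p≤1 = subst (p ^ℚ n ℚ.≤_) (1^ n) (^-mono n 0≤p p≤1)

  ^-monoʳ : ∀ {m n} → 1ℚ ℚ.≤ p → m ℕ.≤ n → p ^ℚ m ℚ.≤ p ^ℚ n
  ^-monoʳ {n = n} 1≤p ℕ.z≤n   = 1≤^ n 1≤p
  ^-monoʳ {p}     1≤p (ℕ.s≤s m≤n) =
    ℚ.*-monoˡ-≤-nonNeg p {{ℚ.nonNegative (ℚ.≤-trans 0≤1 1≤p)}} (^-monoʳ 1≤p m≤n)

  ^-+ : ∀ p m n → p ^ℚ (m ℕ.+ n) ≡ p ^ℚ m ℚ.* p ^ℚ n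
  ^-+ p zero    n = sym (ℚ.*-identityˡ _)
  ^-+ p (suc m) n = trans (cong (p ℚ.*_) (^-+ p m n)) (sym (ℚ.*-assoc p _ _))

  ^-* : ∀ p m n → (p ^ℚ m) ^ℚ n ≡ p ^ℚ (n ℕ.* m)
  ^-* p m zero    = refl
  ^-* p m (suc n) = trans (cong (p ^ℚ m ℚ.*_) (^-* p m n)) (sym (^-+ p m (n ℕ.* m)))

-- A real number x is a Dedekind cut, given by its lower set { q ∈ ℚ | q < x }.
-- The cut need not be located: classically these are exactly the real numbers,
-- and constructively every located two-sided cut gives one of them.

infix 4 _◃_ _⊴_

record ℝ : Set₁ where
  field
    Below     : ℚ → Set
    inhabited : ∃ Below
    bounded   : ∃ λ u → ∀ {q} → Below q → q ℚ.≤ u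
    downward  : ∀ {p q} → p ℚ.≤ q → Below q → Below p
    rounded   : ∀ {q} → Below q → ∃ λ r → q ℚ.< r × Below r

open ℝ

_◃_ : ℚ → ℝ → Set
q ◃ x = Below x q

-- x ⊴ u says x ≤ u.
_⊴_ : ℝ → ℚ → Set
x ⊴ u = ∀ {q} → q ◃ x → q ℚ.≤ u

infix 4 _≤ᴿ_ _<ᴿ_

_≤ᴿ_ : ℝ → ℝ → Set
x ≤ᴿ y = ∀ {q} → q ◃ x → q ◃ y

_<ᴿ_ : ℝ → ℝ → Set
x <ᴿ y = ∃ λ q → x ⊴ q × q ◃ y

fromℚ : ℚ → ℝ
fromℚ p = record
  { Below     = ℚ._< p
  ; inhabited = p ℚ.- 1ℚ , p-1<p p
  ; bounded   = p , ℚ.<⇒≤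
  ; downward  = ℚ.≤-<-trans
  ; rounded   = ℚ.<-dense
  }

fromℤ : ℤ → ℝ
fromℤ i = fromℚ (i ℚ./ 1)

fromℕ : ℕ → ℝ
fromℕ n = fromℤ (+ n)

0ᴿ 1ᴿ 2ᴿ : ℝ
0ᴿ = fromℚ 0ℚ
1ᴿ = fromℚ 1ℚ
2ᴿ = fromℕ 2

infixl 6 _+ᴿ_

_+ᴿ_ : ℝ → ℝ → ℝ
x +ᴿ y = record
  { Below     = λ q → ∃ λ a → ∃ λ b → a ◃ x × b ◃ y × q ℚ.≤ a ℚ.+ b
  ; inhabited = let a , a◃x = inhabited x ; b , b◃y = inhabited y in
      a ℚ.+ b , a , b , a◃x , b◃y , ℚ.≤-refl
  ; bounded   = let u , x⊴u = bounded x ; v , y⊴v = bounded y in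
      u ℚ.+ v , λ (a , b , a◃x , b◃y , q≤) → ℚ.≤-trans q≤ (ℚ.+-mono-≤ (x⊴u a◃x) (y⊴v b◃y))
  ; downward  = λ p≤q (a , b , a◃x , b◃y , q≤) → a , b , a◃x , b◃y , ℚ.≤-trans p≤q q≤
  ; rounded   = λ (a , b , a◃x , b◃y , q≤) →
      let a′ , a<a′ , a′◃x = rounded x a◃x
          b′ , b<b′ , b′◃y = rounded y b◃y
      in a′ ℚ.+ b′ , ℚ.≤-<-trans q≤ (ℚ.+-mono-< a<a′ b<b′) , a′ , b′ , a′◃x , b′◃y , ℚ.≤-refl
  }

corners⊓ : ℚ → ℚ → ℚ → ℚ → ℚ
corners⊓ a a′ b b′ = ((a ℚ.* b) ℚ.⊓ (a ℚ.* b′)) ℚ.⊓ ((a′ ℚ.* b) ℚ.⊓ (a′ ℚ.* b′))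

private
  corners⊔ : ℚ → ℚ → ℚ → ℚ → ℚ
  corners⊔ a a′ b b′ = (a ℚ.* b ℚ.⊔ a ℚ.* b′) ℚ.⊔ (a′ ℚ.* b ℚ.⊔ a′ ℚ.* b′)

  edge⊓ : ∀ {a a′ c} d → a ℚ.≤ c → c ℚ.≤ a′ → (a ℚ.* d) ℚ.⊓ (a′ ℚ.* d) ℚ.≤ c ℚ.* d
  edge⊓ {a} {a′} d a≤c c≤a′ with ℚ.≤-total 0ℚ d
  ... | inj₁ 0≤d = ℚ.≤-trans (ℚ.p⊓q≤p (a ℚ.* d) (a′ ℚ.* d)) (ℚ.*-monoʳ-≤-nonNeg d {{ℚ.nonNegative 0≤d}} a≤c)
  ... | inj₂ d≤0 = ℚ.≤-trans (ℚ.p⊓q≤q (a ℚ.* d) (a′ ℚ.* d)) (ℚ.*-monoʳ-≤-nonPos d {{ℚ.nonPositive d≤0}} c≤a′)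

  edge⊔ : ∀ {a a′ c} d → a ℚ.≤ c → c ℚ.≤ a′ → c ℚ.* d ℚ.≤ a ℚ.* d ℚ.⊔ a′ ℚ.* d
  edge⊔ {a} {a′} d a≤c c≤a′ with ℚ.≤-total 0ℚ d
  ... | inj₁ 0≤d = ℚ.≤-trans (ℚ.*-monoʳ-≤-nonNeg d {{ℚ.nonNegative 0≤d}} c≤a′) (ℚ.p≤q⊔p (a ℚ.* d) (a′ ℚ.* d))
  ... | inj₂ d≤0 = ℚ.≤-trans (ℚ.*-monoʳ-≤-nonPos d {{ℚ.nonPositive d≤0}} a≤c) (ℚ.p≤p⊔q (a ℚ.* d) (a′ ℚ.* d))

  edge⊓′ : ∀ {b b′ d} c → b ℚ.≤ d → d ℚ.≤ b′ → (c ℚ.* b) ℚ.⊓ (c ℚ.* b′) ℚ.≤ c ℚ.* d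
  edge⊓′ {b} {b′} {d} c b≤d d≤b′
    rewrite ℚ.*-comm c b | ℚ.*-comm c b′ | ℚ.*-comm c d = edge⊓ c b≤d d≤b′

  edge⊔′ : ∀ {b b′ d} c → b ℚ.≤ d → d ℚ.≤ b′ → c ℚ.* d ℚ.≤ c ℚ.* b ℚ.⊔ c ℚ.* b′
  edge⊔′ {b} {b′} {d} c b≤d d≤b′
    rewrite ℚ.*-comm c b | ℚ.*-comm c b′ | ℚ.*-comm c d = edge⊔ c b≤d d≤b′

  corners⊓≤ : ∀ {a a′ b b′ c d} → a ℚ.≤ c → c ℚ.≤ a′ → b ℚ.≤ d → d ℚ.≤ b′ →
              corners⊓ a a′ b b′ ℚ.≤ c ℚ.* d
  corners⊓≤ {a} {a′} {d = d} a≤c c≤a′ b≤d d≤b′ = ℚ.≤-trans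
    (ℚ.⊓-mono-≤ (edge⊓′ a b≤d d≤b′) (edge⊓′ a′ b≤d d≤b′)) (edge⊓ d a≤c c≤a′)

  ≤corners⊔ : ∀ {a a′ b b′ c d} → a ℚ.≤ c → c ℚ.≤ a′ → b ℚ.≤ d → d ℚ.≤ b′ →
              c ℚ.* d ℚ.≤ corners⊔ a a′ b b′
  ≤corners⊔ {a} {a′} {d = d} a≤c c≤a′ b≤d d≤b′ = ℚ.≤-trans
    (edge⊔ d a≤c c≤a′) (ℚ.⊔-mono-≤ (edge⊔′ a b≤d d≤b′) (edge⊔′ a′ b≤d d≤b′))

  ◃-⊔ : ∀ (x : ℝ) {a b} → a ◃ x → b ◃ x → a ℚ.⊔ b ◃ x
  ◃-⊔ x {a} {b} a◃x b◃x with ℚ.⊔-sel a b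
  ... | inj₁ eq = subst (_◃ x) (sym eq) a◃x
  ... | inj₂ eq = subst (_◃ x) (sym eq) b◃x

infixl 7 _*ᴿ_

-- Interval multiplication, for arbitrary signs: q < xy iff q lies below the product of some pair of
-- rational intervals (a, a′] ∋ x and (b, b′] ∋ y.
_*ᴿ_ : ℝ → ℝ → ℝ
x *ᴿ y = record
  { Below     = λ q → ∃ λ a → ∃ λ a′ → ∃ λ b → ∃ λ b′ →
                  (a ◃ x × x ⊴ a′) × (b ◃ y × y ⊴ b′) × q ℚ.< corners⊓ a a′ b b′
  ; inhabited = let a , a◃x = inhabited x ; a′ , x⊴a′ = bounded x
                    b , b◃y = inhabited y ; b′ , y⊴b′ = bounded y
      in _ , a , a′ , b , b′ , (a◃x , x⊴a′) , (b◃y , y⊴b′) , p-1<p _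
  ; bounded   = let a₀ , a₀◃x = inhabited x ; a₀′ , x⊴a₀′ = bounded x
                    b₀ , b₀◃y = inhabited y ; b₀′ , y⊴b₀′ = bounded y
      in corners⊔ a₀ a₀′ b₀ b₀′ , λ (a , a′ , b , b′ , (a◃x , x⊴a′) , (b◃y , y⊴b′) , q<) →
        let c◃x = ◃-⊔ x a◃x a₀◃x ; d◃y = ◃-⊔ y b◃y b₀◃y in
        ℚ.≤-trans (ℚ.<⇒≤ q<) (ℚ.≤-trans
          (corners⊓≤ {a} {a′} {b} {b′} (ℚ.p≤p⊔q a a₀) (x⊴a′ c◃x) (ℚ.p≤p⊔q b b₀) (y⊴b′ d◃y))
          (≤corners⊔ {a₀} {a₀′} {b₀} {b₀′} (ℚ.p≤q⊔p a a₀) (x⊴a₀′ c◃x) (ℚ.p≤q⊔p b b₀) (y⊴b₀′ d◃y)))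
  ; downward  = λ p≤q (a , a′ , b , b′ , A , B , q<) → a , a′ , b , b′ , A , B , ℚ.≤-<-trans p≤q q<
  ; rounded   = λ (a , a′ , b , b′ , A , B , q<) →
      let r , q<r , r< = ℚ.<-dense q< in r , q<r , a , a′ , b , b′ , A , B , r<
  }

infix 2 _,⁺_

record ℝ⁺ : Set₁ where
  constructor _,⁺_
  field
    value    : ℝ
    positive : 0ᴿ <ᴿ value

open ℝ⁺ public using (value)
open ℝ⁺ using (positive)

private
  0<⇒◃ : ∀ (x : ℝ⁺) → ∃ λ a → 0ℚ ℚ.< a × a ◃ value x
  0<⇒◃ x with positive x
  ... | q , 0⊴q , q◃x with rounded (value x) q◃x | ℚ._≤?_ 0ℚ q
  ... | r , q<r , r◃x | yes 0≤q = r , ℚ.≤-<-trans 0≤q q<r , r◃x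
  ... | r , q<r , r◃x | no  0≰q =
    let m , q<m , m<0 = ℚ.<-dense (ℚ.≰⇒> 0≰q) in ⊥-elim (<⇒≱ q<m (0⊴q m<0))

  ◃⇒0< : ∀ {a} (x : ℝ) → 0ℚ ℚ.< a → a ◃ x → 0ᴿ <ᴿ x
  ◃⇒0< {a} x 0<a a◃x = a , (λ p<0 → ℚ.<⇒≤ (ℚ.<-trans p<0 0<a)) , a◃x

  ◃∧⊴⇒0< : ∀ (x : ℝ⁺) {u} → value x ⊴ u → 0ℚ ℚ.< u
  ◃∧⊴⇒0< x x⊴u = let a , 0<a , a◃x = 0<⇒◃ x in ℚ.<-≤-trans 0<a (x⊴u a◃x)

  recip : 0ℚ ℚ.< p → ∃ λ i → 0ℚ ℚ.< i × i ℚ.* p ≡ 1ℚ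
  recip {p} 0<p = (ℚ.1/ p) {{p≢0}} , ℚ.positive⁻¹ _ {{ℚ.1/pos⇒pos p {{ℚ.positive 0<p}}}}
                , ℚ.*-inverseˡ p {{p≢0}}
    where
    p≢0 : ℚ.NonZero p
    p≢0 = ℚ.pos⇒nonZero p {{ℚ.positive 0<p}}

1⁺ : ℝ⁺
1⁺ = 1ᴿ ,⁺ (0ℚ , ℚ.<⇒≤ , 0<1)

infixl 7 _*⁺_ _/⁺_
infix  8 _⁻¹

_*⁺_ : ℝ⁺ → ℝ⁺ → ℝ⁺
x *⁺ y = value x *ᴿ value y ,⁺ pos
  where
  pos : 0ᴿ <ᴿ value x *ᴿ value y
  pos = let a , 0<a , a◃x = 0<⇒◃ x ; a′ , x⊴a′ = bounded (value x)
            b , 0<b , b◃y = 0<⇒◃ y ; b′ , y⊴b′ = bounded (value y)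
            0<a′ = ◃∧⊴⇒0< x x⊴a′   ; 0<b′ = ◃∧⊴⇒0< y y⊴b′
        in 0ℚ , ℚ.<⇒≤ , a , a′ , b , b′ , (a◃x , x⊴a′) , (b◃y , y⊴b′) ,
           <-⊓ (<-⊓ (*-pos 0<a 0<b) (*-pos 0<a 0<b′)) (<-⊓ (*-pos 0<a′ 0<b) (*-pos 0<a′ 0<b′))

-- q < 1/x iff some r > q satisfies r ≤ 1/x, that is, r x ≤ 1.
_⁻¹ : ℝ⁺ → ℝ⁺
x ⁻¹ = inv ,⁺ pos
  where
  inv : ℝ
  inv = record
    { Below     = λ q → ∃ λ r → q ℚ.< r × (∀ {a} → 0ℚ ℚ.< a → a ◃ value x → r ℚ.* a ℚ.≤ 1ℚ)
    ; inhabited = ℚ.- 1ℚ , 0ℚ , ℚ.negative⁻¹ (ℚ.- 1ℚ) ,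
        λ {a} _ _ → subst (ℚ._≤ 1ℚ) (sym (ℚ.*-zeroˡ a)) 0≤1
    ; bounded   = let a , 0<a , a◃x = 0<⇒◃ x ; i , 0<i , ia≡1 = recip 0<a in
        i , λ (r , q<r , rx≤1) → ℚ.≤-trans (ℚ.<⇒≤ q<r)
          (ℚ.*-cancelʳ-≤-pos a {{ℚ.positive 0<a}}
            (subst (r ℚ.* a ℚ.≤_) (sym ia≡1) (rx≤1 0<a a◃x)))
    ; downward  = λ p≤q (r , q<r , rx≤1) → r , ℚ.≤-<-trans p≤q q<r , rx≤1
    ; rounded   = λ (r , q<r , rx≤1) →
        let s , q<s , s<r = ℚ.<-dense q<r in s , q<s , r , s<r , rx≤1
    }

  pos : 0ᴿ <ᴿ inv
  pos = let u , x⊴u = bounded (value x) ; i , 0<i , iu≡1 = recip (◃∧⊴⇒0< x x⊴u) in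
    0ℚ , ℚ.<⇒≤ , i , 0<i , λ {a} _ a◃x →
      subst (i ℚ.* a ℚ.≤_) iu≡1 (ℚ.*-monoˡ-≤-nonNeg i {{ℚ.nonNegative (ℚ.<⇒≤ 0<i)}} (x⊴u a◃x))

_/⁺_ : ℝ⁺ → ℝ⁺ → ℝ⁺
x /⁺ y = x *⁺ y ⁻¹

private
  pow-bound : ∀ {M y p} m d N → 1ℚ ℚ.≤ M → 0ℚ ℚ.< y → y ℚ.≤ M →
              p ^ℚ suc d ℚ.≤ y ^ℚ m → m ℕ.≤ N ℕ.* suc d → p ℚ.≤ M ^ℚ N
  pow-bound {M} {y} {p} m d N 1≤M 0<y y≤M p^≤y^ m≤ with p ℚ.≤? M ^ℚ N
  ... | yes p≤ = p≤
  ... | no  p≰ = ⊥-elim (<⇒≱ M^<p^ p^≤M^)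
    where
    M^<p^ : M ^ℚ (suc d ℕ.* N) ℚ.< p ^ℚ suc d
    M^<p^ = subst (ℚ._< p ^ℚ suc d) (^-* M N (suc d))
      (^-mono-< d (^-nonNeg N (ℚ.≤-trans 0≤1 1≤M)) (ℚ.≰⇒> p≰))

    p^≤M^ : p ^ℚ suc d ℚ.≤ M ^ℚ (suc d ℕ.* N)
    p^≤M^ = ℚ.≤-trans p^≤y^ (ℚ.≤-trans (^-mono m (ℚ.<⇒≤ 0<y) y≤M)
      (^-monoʳ 1≤M (subst (m ℕ.≤_) (ℕ.*-comm N (suc d)) m≤)))

-- x ^ (m / (d + 1)) is the supremum of the p with p ^ (d + 1) ≤ y ^ m for some y < x.
powℕ/ : ℝ⁺ → (m d : ℕ) → ℝ⁺
powℕ/ x m d = pow ,⁺ pos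
  where
  Pow : ℚ → Set
  Pow q = ∃ λ p → ∃ λ y → q ℚ.< p × 0ℚ ℚ.< p × 0ℚ ℚ.< y × y ◃ value x × p ^ℚ suc d ℚ.≤ y ^ℚ m

  Pow0 : Pow 0ℚ
  Pow0 = let y , 0<y , y◃x = 0<⇒◃ x
             0<p = <-⊓ 0<1 (^-pos m 0<y)
             p = 1ℚ ℚ.⊓ y ^ℚ m
             p^d≤1 = ^≤1 d (ℚ.<⇒≤ 0<p) (ℚ.p⊓q≤p 1ℚ (y ^ℚ m))
         in p , y , 0<p , 0<p , 0<y , y◃x ,
            ℚ.≤-trans (subst (p ℚ.* p ^ℚ d ℚ.≤_) (ℚ.*-identityʳ p)
                         (ℚ.*-monoˡ-≤-nonNeg p {{ℚ.nonNegative (ℚ.<⇒≤ 0<p)}} p^d≤1))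
                      (ℚ.p⊓q≤q 1ℚ (y ^ℚ m))

  pow : ℝ
  pow = record
    { Below     = Pow
    ; inhabited = 0ℚ , Pow0
    ; bounded   = let u , x⊴u = bounded (value x) in
        (1ℚ ℚ.⊔ u) ^ℚ m , λ (p , y , q<p , _ , 0<y , y◃x , p^≤y^) →
          ℚ.≤-trans (ℚ.<⇒≤ q<p)
            (pow-bound m d m (ℚ.p≤p⊔q 1ℚ u) 0<y (ℚ.≤-trans (x⊴u y◃x) (ℚ.p≤q⊔p 1ℚ u)) p^≤y^
              (ℕ.m≤m*n m (suc d)))
    ; downward  = λ p≤q (p , y , q<p , P) → p , y , ℚ.≤-<-trans p≤q q<p , P
    ; rounded   = λ (p , y , q<p , P) →
        let r , q<r , r<p = ℚ.<-dense q<p in r , q<r , p , y , r<p , P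
    }

  pos : 0ᴿ <ᴿ pow
  pos = 0ℚ , ℚ.<⇒≤ , Pow0

-- The constructor mkℚ n d stands for the fraction n / (d + 1).
powℚ : ℝ⁺ → ℚ → ℝ⁺
powℚ x (mkℚ (+ m)    d _) = powℕ/ x m d
powℚ x (mkℚ -[1+ m ] d _) = powℕ/ (x ⁻¹) (suc m) d

private
  ↥-bound⁺ : ∀ {m d} .{c : Coprime m (suc d)} (u : ℚ) → mkℚ (+ m) d c ℚ.≤ u → m ℕ.≤ ℤ.∣ ↥ u ∣ ℕ.* suc d
  ↥-bound⁺ {m} {d} u@(mkℚ (+ n) e _) (ℚ.*≤* h) = ℕ.≤-trans (ℕ.m≤m*n m (suc e))
    (ℤ.drop‿+≤+ (subst₂ ℤ._≤_ (sym (ℤ.pos-* m (suc e))) (sym (ℤ.pos-* n (suc d))) h))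
  ↥-bound⁺ {zero}  (mkℚ -[1+ n ] e _) h = ℕ.z≤n
  ↥-bound⁺ {suc m} (mkℚ -[1+ n ] e _) (ℚ.*≤* ())

  ↥-bound⁻ : ∀ {m d} .{c : Coprime (suc m) (suc d)} (u : ℚ) → u ℚ.≤ mkℚ -[1+ m ] d c → suc m ℕ.≤ ℤ.∣ ↥ u ∣ ℕ.* suc d
  ↥-bound⁻ {m} {d} {c} u h = subst (λ n → suc m ℕ.≤ n ℕ.* suc d) (neg-↥ u)
    (↥-bound⁺ (ℚ.- u) (ℚ.neg-antimono-≤ h))
    where
    neg-↥ : ∀ u → ℤ.∣ ↥ (ℚ.- u) ∣ ≡ ℤ.∣ ↥ u ∣
    neg-↥ (mkℚ (+ zero)  _ _) = refl
    neg-↥ (mkℚ (+ suc _) _ _) = refl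
    neg-↥ (mkℚ -[1+ _ ]  _ _) = refl

  powℕ/-≤ : ∀ {M q} (x : ℝ⁺) m d N → 1ℚ ℚ.≤ M → value x ⊴ M → m ℕ.≤ N ℕ.* suc d →
            q ◃ value (powℕ/ x m d) → q ℚ.≤ M ^ℚ N
  powℕ/-≤ x m d N 1≤M x⊴M m≤ (p , y , q<p , _ , 0<y , y◃x , p^≤y^) =
    ℚ.≤-trans (ℚ.<⇒≤ q<p) (pow-bound m d N 1≤M 0<y (x⊴M y◃x) p^≤y^ m≤)

  1<powℕ/ : ∀ {q} (x : ℝ⁺) m d → 1ℚ ℚ.< q → q ◃ value (powℕ/ x m d) → ∃ λ y → 1ℚ ℚ.< y × y ◃ value x
  1<powℕ/ {q} x m d 1<q (p , y , q<p , _ , 0<y , y◃x , p^≤y^) with y ℚ.≤? 1ℚ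
  ... | no  y≰1 = y , ℚ.≰⇒> y≰1 , y◃x
  ... | yes y≤1 = ⊥-elim (<⇒≱ 1<p^ (ℚ.≤-trans p^≤y^ (^≤1 m (ℚ.<⇒≤ 0<y) y≤1)))
    where
    1<p^ : 1ℚ ℚ.< p ^ℚ suc d
    1<p^ = subst (ℚ._< p ^ℚ suc d) (1^ (suc d)) (^-mono-< d 0≤1 (ℚ.<-trans 1<q q<p))

  ⁻¹-disjoint : ∀ {y z} (x : ℝ⁺) → 1ℚ ℚ.< y → y ◃ value x → 1ℚ ℚ.< z → z ◃ value (x ⁻¹) → 1ℚ ℚ.< 0ℚ
  ⁻¹-disjoint x 1<y y◃x 1<z (r , z<r , rx≤1) =
    ⊥-elim (<⇒≱ (1<* (ℚ.<-trans 1<z z<r) 1<y) (rx≤1 (ℚ.<-trans 0<1 1<y) y◃x))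

infixr 8 _^_

-- On rational exponents, t ↦ x ^ t is increasing if x ≥ 1 and decreasing if
-- x ≤ 1.  So x ^ s is the supremum of min (x ^ t) (x ^ t′) over rational t, t′
-- with t < s ≤ t′, and no case distinction on x is needed.
_^_ : ℝ⁺ → ℝ → ℝ⁺
x ^ s = pow ,⁺ pos
  where
  Pow : ℚ → Set
  Pow q = ∃ λ t → ∃ λ t′ → t ◃ s × s ⊴ t′ × q ◃ value (powℚ x t) × q ◃ value (powℚ x t′)

  Pow⁺ : ∃ λ q → 0ℚ ℚ.< q × Pow q
  Pow⁺ = let t , t◃s = inhabited s ; t′ , s⊴t′ = bounded s
             q , 0<q , q◃ = 0<⇒◃ (powℚ x t) ; r , 0<r , r◃ = 0<⇒◃ (powℚ x t′)
         in q ℚ.⊓ r , <-⊓ 0<q 0<r , t , t′ , t◃s , s⊴t′ ,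
            downward (value (powℚ x t)) (ℚ.p⊓q≤p q r) q◃ ,
            downward (value (powℚ x t′)) (ℚ.p⊓q≤q q r) r◃

  u₁ u₂ M : ℚ
  u₁ = proj₁ (bounded (value x))
  u₂ = proj₁ (bounded (value (x ⁻¹)))
  M = (1ℚ ℚ.⊔ u₁) ℚ.⊔ u₂

  1≤M : 1ℚ ℚ.≤ M
  1≤M = ℚ.≤-trans (ℚ.p≤p⊔q 1ℚ u₁) (ℚ.p≤p⊔q (1ℚ ℚ.⊔ u₁) u₂)

  x⊴M : value x ⊴ M
  x⊴M a◃x = ℚ.≤-trans (proj₂ (bounded (value x)) a◃x) (ℚ.≤-trans (ℚ.p≤q⊔p 1ℚ u₁) (ℚ.p≤p⊔q (1ℚ ℚ.⊔ u₁) u₂))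

  x⁻¹⊴M : value (x ⁻¹) ⊴ M
  x⁻¹⊴M {a} a◃ = ℚ.≤-trans (proj₂ (bounded (value (x ⁻¹))) {a} a◃) (ℚ.p≤q⊔p (1ℚ ℚ.⊔ u₁) u₂)

  t₀ t₀′ : ℚ
  t₀  = proj₁ (inhabited s)
  t₀′ = proj₁ (bounded s)

  N : ℕ
  N = ℤ.∣ ↥ t₀ ∣ ℕ.+ ℤ.∣ ↥ t₀′ ∣

  bound : ∀ {q} t t′ → t ℚ.≤ t₀′ → t₀ ℚ.≤ t′ →
          q ◃ value (powℚ x t) → q ◃ value (powℚ x t′) → q ℚ.≤ M ^ℚ N
  bound (mkℚ (+ m) d _) t′ t≤ t₀≤ h h′ = powℕ/-≤ x m d N 1≤M x⊴M
    (ℕ.≤-trans (↥-bound⁺ t₀′ t≤) (ℕ.*-monoˡ-≤ (suc d) (ℕ.m≤n+m _ ℤ.∣ ↥ t₀ ∣))) h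
  bound (mkℚ -[1+ m ] d _) (mkℚ -[1+ n ] e _) t≤ t₀≤ h h′ =
    powℕ/-≤ (x ⁻¹) (suc n) e N 1≤M (λ {a} → x⁻¹⊴M {a})
    (ℕ.≤-trans (↥-bound⁻ t₀ t₀≤) (ℕ.*-monoˡ-≤ (suc e) (ℕ.m≤m+n ℤ.∣ ↥ t₀ ∣ _))) h′
  bound {q} (mkℚ -[1+ m ] d _) (mkℚ (+ n) e _) t≤ t₀≤ h h′ with q ℚ.≤? 1ℚ
  ... | yes q≤1 = ℚ.≤-trans q≤1 (1≤^ N 1≤M)
  ... | no  q≰1 =
    let y , 1<y , y◃ = 1<powℕ/ x n e (ℚ.≰⇒> q≰1) h′
        z , 1<z , z◃ = 1<powℕ/ (x ⁻¹) (suc m) d (ℚ.≰⇒> q≰1) h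
    in ⊥-elim (ℚ.<-asym 0<1 (⁻¹-disjoint x 1<y y◃ 1<z z◃))

  pow : ℝ
  pow = record
    { Below     = Pow
    ; inhabited = let q , _ , P = Pow⁺ in q , P
    ; bounded   = M ^ℚ N , λ (t , t′ , t◃s , s⊴t′ , h , h′) →
        bound t t′ (proj₂ (bounded s) t◃s) (s⊴t′ (proj₂ (inhabited s))) h h′
    ; downward  = λ p≤q (t , t′ , t◃s , s⊴t′ , h , h′) → t , t′ , t◃s , s⊴t′ ,
        downward (value (powℚ x t)) p≤q h , downward (value (powℚ x t′)) p≤q h′
    ; rounded   = λ (t , t′ , t◃s , s⊴t′ , h , h′) →
        let a , q<a , a◃ = rounded (value (powℚ x t)) h
            b , q<b , b◃ = rounded (value (powℚ x t′)) h′
        in a ℚ.⊓ b , <-⊓ q<a q<b , t , t′ , t◃s , s⊴t′ ,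
           downward (value (powℚ x t)) (ℚ.p⊓q≤p a b) a◃ ,
           downward (value (powℚ x t′)) (ℚ.p⊓q≤q a b) b◃
    }

  pos : 0ᴿ <ᴿ pow
  pos = let q , 0<q , P = Pow⁺ in ◃⇒0< pow 0<q P

infix 7 _/[_-1]

-- The rational n / (k - 1), for k ≥ 2.
_/[_-1] : ℕ → (k : ℕ) .{{_ : NonTrivial k}} → ℚ
n /[ suc (suc k) -1] = + n ℚ./ suc k

∏⁺ : ∀ {k} → (Fin k → ℝ⁺) → ℝ⁺
∏⁺ = F.foldr _*⁺_ 1⁺

∏ℕ : ∀ {k} → (Fin k → ℕ) → ℕ
∏ℕ = F.foldr ℕ._*_ 1

-- Cardinality is the length of a duplicate-free enumeration.
record FiniteSet (A : Set) : Set where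
  field
    elements : List A
    unique   : Unique elements

open FiniteSet

infix 4 _∈_

_∈_ : ∀ {A} → A → FiniteSet A → Set
a ∈ S = a List.∈ elements S

∣_∣ : ∀ {A} → FiniteSet A → ℕ
∣ S ∣ = length (elements S)

lcms : ∀ {k} → Vec ℤ k → ℤ
lcms = Vec.foldr′ ℤ.lcm (+ 1)

{-# OPTIONS --safe #-}
module Submission where

-- Fix a coordinate i and write x for the least element of A i.  A tuple a with
-- lcm(a) = m ≤ ℓ is determined by its entry aᵢ, by the cofactor m / aᵢ ≤ ℓ / x, and by
-- the choice of all entries among the divisors of m, so the divisor bound gives
-- t x ≤ |A i| ℓ^(1+o(1)) for the number t of such tuples.  Multiplying these bounds
-- over all i and taking a (k − 1)-th root yields the theorem.
--
-- Cuts need not be located, so rational bounds on the right sides must come from the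
-- data: min (A i) bounds X i from above, the largest lcm occurring bounds L from
-- below, and t / ∏|A i| bounds δ from above.  Powers are then compared with rational
-- roots that are exact up to a factor 2, which the constant absorbs.

open import Defs
open import Algebra.Bundles using (CommutativeRing)
open import Data.Fin using (Fin; zero; suc)
open import Data.Fin.Properties using (injective⇒≤)
open import Data.Integer using (ℤ)
import Data.Integer as ℤ
import Data.Integer.Properties as ℤ
open import Data.List as List using (List; []; _∷_; [_]; length; map; concatMap; cartesianProductWith; upTo)
open import Data.List.Membership.Propositional using (lose) renaming (_∈_ to _∈ˡ_)
open import Data.List.Membership.Propositional.Properties
  using (∈-lookup; ∈-cartesianProductWith⁺; ∈-concatMap⁺; ∈-upTo⁺; ∈-map⁺)
open import Data.List.Properties using (length-++; length-map; length-upTo)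
open import Data.List.Relation.Binary.Subset.Propositional using (_⊆_)
import Data.List.Relation.Unary.All as All
open import Data.List.Relation.Unary.AllPairs using (_∷_)
open import Data.List.Relation.Unary.Any using (here; there; index)
open import Data.List.Relation.Unary.Any.Properties using (lookup-index)
open import Data.List.Relation.Unary.Unique.Propositional using (Unique)
open import Data.Nat as ℕ using (ℕ; zero; suc; _+_; _*_; _∸_; _/_; _≤_; _<_; NonZero; NonTrivial; z≤n; s≤s) renaming (_^_ to _^ℕ_)
open import Data.Nat.Coprimality as Coprime using (1-coprimeTo)
open import Data.Nat.Divisibility using (_∣_; _∣?_; _∤_; divides; ∣-trans; ∣1⇒≡1; ∣⇒≤)
open import Data.Nat.DivMod using (m/n*n≤m; m*n/n≡m; /-monoˡ-≤; m≡m%n+[m/n]*n; m%n<n)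
open import Data.Nat.GCD using (gcd)
open import Data.Nat.Induction using (<-rec)
import Data.Nat.LCM as ℕ
open import Data.Nat.Primality
  using (Prime; _Rough_; euclidsLemma; rough∧∣⇒prime; rough∧∣⇒rough; rough⇒≤; ∤⇒rough-suc; 2-rough; prime⇒nonZero)
open import Data.Nat.Properties as ℕ using
  (*-assoc; *-cancelˡ-≡; *-comm; *-identityʳ; *-identityˡ; *-mono-<; *-mono-≤; *-monoʳ-≤; *-monoˡ-≤; *-zeroʳ;
   +-identityʳ; +-mono-≤; +-monoˡ-≤; +-suc; +-∸-assoc; <⇒≢; <⇒≱; [m*n]*[o*p]≡[m*o]*[n*p]; ^-*-assoc;
   ^-monoʳ-≤; ^-monoˡ-<; ^-monoˡ-≤; ^-zeroˡ; _<?_; _≤?_; m<m*n; m^n>0; module ≤-Reasoning; m≤n⇒m≤1+n; n<1+n;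
   n≢0⇒n>0; n≤1+n; ∸-monoʳ-≤; ≤-<-trans; ≤-refl; ≤-reflexive; ≤-totalOrder; ≤-trans; ≤⇒≯; ≮⇒≥; ≰⇒>)
open import Data.List.Extrema ≤-totalOrder
  using (argmin; argmax; argmin-sel; argmax-sel; f[argmin]≤f[⊤]; f[argmin]≤f[xs]; f[⊥]≤f[argmax]; f[xs]≤f[argmax])
open import Data.Nat.Tactic.RingSolver using (solve-∀)
open import Data.Product using (Σ; ∃; ∃₂; _×_; _,_; proj₁; proj₂)
open import Data.Rational as ℚ using (ℚ; mkℚ; 0ℚ; 1ℚ; ½; -_)
import Data.Rational.Properties as ℚ
open import Data.Rational.Solver using (module +-*-Solver)
open import Data.Rational.Unnormalised as ℚᵘ using (mkℚᵘ; *≡*)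
import Data.Rational.Unnormalised.Properties as ℚᵘ
open import Data.Sum using (inj₁; inj₂)
open import Data.Vec as Vec using (Vec; []; _∷_; lookup)
open import Function using (_∘_)
open import Relation.Binary.PropositionalEquality using (_≡_; refl; sym; trans; cong; cong₂; subst; subst₂)
open import Relation.Nullary using (Dec; yes; no; contradiction)
open import Algebra.Definitions.RawSemiring ℚ.+-*-rawSemiring using () renaming (_^_ to _^ℚ_)
import Algebra.Properties.CommutativeSemiring.Exp (CommutativeRing.commutativeSemiring ℚ.+-*-commutativeRing) as Exp

open FiniteSet
open ℝ

-- Counting with duplicate-free lists

module _ {A : Set} where

  lookup-injective : ∀ {xs : List A} → Unique xs → ∀ {i j} → List.lookup xs i ≡ List.lookup xs j → i ≡ j
  lookup-injective (x∉ ∷ u) {zero}  {zero}  eq = refl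
  lookup-injective (x∉ ∷ u) {zero}  {suc j} eq = contradiction eq (All.lookup x∉ (∈-lookup j))
  lookup-injective (x∉ ∷ u) {suc i} {zero}  eq = contradiction (sym eq) (All.lookup x∉ (∈-lookup i))
  lookup-injective (x∉ ∷ u) {suc i} {suc j} eq = cong suc (lookup-injective u eq)

  -- Pigeonhole: sending each position of `xs` to a position of the same element in `ys` is
  -- injective, because equal images carry equal elements and `xs` has no repetitions.
  unique∧⊆⇒length≤ : ∀ {xs ys : List A} → Unique xs → xs ⊆ ys → length xs ≤ length ys
  unique∧⊆⇒length≤ {xs} {ys} u xs⊆ys = injective⇒≤ {f = λ i → index (xs⊆ys (∈-lookup i))} λ {i} {j} eq →
    lookup-injective u (trans (lookup-index (xs⊆ys (∈-lookup i)))
      (trans (cong (List.lookup ys) eq) (sym (lookup-index (xs⊆ys (∈-lookup j))))))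

length-cartesianProductWith : ∀ {A B C : Set} (f : A → B → C) xs ys →
                              length (cartesianProductWith f xs ys) ≡ length xs * length ys
length-cartesianProductWith f []       ys = refl
length-cartesianProductWith f (x ∷ xs) ys = trans (length-++ (map (f x) ys))
  (cong₂ _+_ (length-map (f x) ys) (length-cartesianProductWith f xs ys))

length-concatMap≤ : ∀ {A B : Set} (f : A → List B) {b} xs → (∀ {x} → x ∈ˡ xs → length (f x) ≤ b) →
                    length (concatMap f xs) ≤ length xs * b
length-concatMap≤ f []       f≤b = z≤n
length-concatMap≤ f (x ∷ xs) f≤b = ≤-trans (≤-reflexive (length-++ (f x)))
  (+-mono-≤ (f≤b (here refl)) (length-concatMap≤ f xs (f≤b ∘ there)))

vectors : ∀ {A : Set} k → List A → List (Vec A k)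
vectors zero    xs = [ [] ]
vectors (suc k) xs = cartesianProductWith _∷_ xs (vectors k xs)

length-vectors : ∀ {A : Set} k (xs : List A) → length (vectors k xs) ≡ length xs ^ℕ k
length-vectors zero    xs = refl
length-vectors (suc k) xs = trans (length-cartesianProductWith _∷_ xs (vectors k xs))
  (cong (length xs *_) (length-vectors k xs))

∈-vectors : ∀ {A : Set} {k} {xs : List A} (v : Vec A k) → (∀ i → Vec.lookup v i ∈ˡ xs) → v ∈ˡ vectors k xs
∈-vectors []      v∈ = here refl
∈-vectors (x ∷ v) v∈ = ∈-cartesianProductWith⁺ _∷_ (v∈ zero) (∈-vectors v (v∈ ∘ suc))

^-distrib-* : ∀ m n o → (m * n) ^ℕ o ≡ m ^ℕ o * n ^ℕ o
^-distrib-* m n zero    = refl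
^-distrib-* m n (suc o) rewrite ^-distrib-* m n o = [m*n]*[o*p]≡[m*o]*[n*p] m n (m ^ℕ o) (n ^ℕ o)

-- Number of divisors

-- Only upper bounds for the number of divisors are wanted, so a covering list may contain
-- repetitions and further numbers.
Covers : List ℕ → ℕ → Set
Covers ds n = ∀ {d} → d ∣ n → d ∈ˡ ds

-- Induction on `a`. By Euclid's lemma one factor `p` divides the cofactor `c` or `d` itself;
-- cancelling it keeps the exponent `i` in the first case and raises it by one in the second.
∣p^a*m : ∀ {p m} → Prime p → ∀ a {d} → d ∣ p ^ℕ a * m →
         ∃₂ λ i e → i < suc a × e ∣ m × d ≡ p ^ℕ i * e
∣p^a*m {p} {m} pp zero    {d} d∣ = 0 , d , s≤s z≤n , subst (d ∣_) (*-identityˡ m) d∣ , sym (*-identityˡ d)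
∣p^a*m {p} {m} pp (suc a) {d} (divides c eq) with euclidsLemma c d pp (divides (p ^ℕ a * m) (trans (sym eq) (trans (*-assoc p _ m) (*-comm p _))))
... | inj₁ (divides c′ refl) =
  let i , e , i< , e∣m , d≡ = ∣p^a*m pp a (divides c′ (*-cancelˡ-≡ _ _ p {{prime⇒nonZero pp}}
        (trans (sym (*-assoc p _ m)) (trans eq (trans (cong (_* d) (*-comm c′ p)) (*-assoc p c′ d))))))
  in i , e , m≤n⇒m≤1+n i< , e∣m , d≡
... | inj₂ (divides d′ refl) =
  let i , e , i< , e∣m , d≡ = ∣p^a*m pp a (divides c (*-cancelˡ-≡ _ _ p {{prime⇒nonZero pp}}
        (trans (sym (*-assoc p _ m)) (trans eq (trans (sym (*-assoc c d′ p)) (*-comm (c * d′) p))))))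
  in suc i , e , s≤s i< , e∣m , trans (*-comm d′ p) (trans (cong (p *_) d≡) (sym (*-assoc p _ e)))

covers-p^a*m : ∀ {p m ds} → Prime p → ∀ a → Covers ds m →
               Covers (cartesianProductWith (λ i e → p ^ℕ i * e) (upTo (suc a)) ds) (p ^ℕ a * m)
covers-p^a*m pp a cov d∣ with ∣p^a*m pp a d∣
... | i , e , i< , e∣m , refl = ∈-cartesianProductWith⁺ _ (∈-upTo⁺ i<) (cov e∣m)

strip : ∀ p → 2 ≤ p → ∀ n → 0 < n → ∃₂ λ a m → n ≡ p ^ℕ a * m × p ∤ m
strip p 2≤p = <-rec _ λ n rec 0<n → go n rec 0<n
  where
  go : ∀ n → (∀ {m} → m < n → 0 < m → ∃₂ λ a l → m ≡ p ^ℕ a * l × p ∤ l) → 0 < n → _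
  go n rec 0<n with p ∣? n
  ... | no  p∤n = 0 , n , sym (*-identityˡ n) , p∤n
  ... | yes (divides zero refl) = contradiction 0<n λ ()
  ... | yes (divides m@(suc _) refl) with rec (m<m*n m p 2≤p) (s≤s z≤n)
  ...   | a , l , eq , p∤l = suc a , l , trans (cong (_* p) eq) (trans (*-comm _ p) (sym (*-assoc p _ l))) , p∤l

n<2^n : ∀ n → n < 2 ^ℕ n
n<2^n zero    = s≤s z≤n
n<2^n (suc n) = ≤-trans (s≤s (n<2^n n)) (≤-trans (+-monoˡ-≤ (2 ^ℕ n) (m^n>0 2 n))
  (≤-reflexive (cong (2 ^ℕ n +_) (sym (+-identityʳ _)))))

-- Writing a = r j + i with i < r, one has a + 1 ≤ r (j + 1) ≤ r 2 ^ j.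
[1+a]^r≤r^r*2^a : ∀ r .{{_ : NonZero r}} a → suc a ^ℕ r ≤ r ^ℕ r * 2 ^ℕ a
[1+a]^r≤r^r*2^a r a = begin
  suc a ^ℕ r                  ≤⟨ ^-monoˡ-≤ r 1+a≤ ⟩
  (r * 2 ^ℕ (a / r)) ^ℕ r     ≡⟨ ^-distrib-* r _ r ⟩
  r ^ℕ r * (2 ^ℕ (a / r)) ^ℕ r ≡⟨ cong (r ^ℕ r *_) (^-*-assoc 2 (a / r) r) ⟩
  r ^ℕ r * 2 ^ℕ (a / r * r)   ≤⟨ *-monoʳ-≤ (r ^ℕ r) (^-monoʳ-≤ 2 (m/n*n≤m a r)) ⟩
  r ^ℕ r * 2 ^ℕ a             ∎
  where
  open ≤-Reasoning
  1+a≤ : suc a ≤ r * 2 ^ℕ (a / r)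
  1+a≤ = ≤-trans (m<[1+m/n]*n a r) (≤-trans (≤-reflexive (*-comm (suc (a / r)) r)) (*-monoʳ-≤ r (n<2^n (a / r))))
    where
    m<[1+m/n]*n : ∀ m n .{{_ : NonZero n}} → m < suc (m / n) * n
    m<[1+m/n]*n m n = ≤-trans (s≤s (≤-reflexive (m≡m%n+[m/n]*n m n)))
      (+-monoˡ-≤ (m / n * n) (m%n<n m n))

-- Primes from `2 ^ r` on cost no constant, since `1 + a ≤ 2 ^ a`.
[1+a]^r≤p^a : ∀ r a {p} → 2 ^ℕ r ≤ p → suc a ^ℕ r ≤ p ^ℕ a
[1+a]^r≤p^a r a {p} 2^r≤p = begin
  suc a ^ℕ r       ≤⟨ ^-monoˡ-≤ r (n<2^n a) ⟩
  (2 ^ℕ a) ^ℕ r    ≡⟨ ^-*-assoc 2 a r ⟩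
  2 ^ℕ (a * r)     ≡⟨ cong (2 ^ℕ_) (*-comm a r) ⟩
  2 ^ℕ (r * a)     ≡⟨ ^-*-assoc 2 r a ⟨
  (2 ^ℕ r) ^ℕ a    ≤⟨ ^-monoˡ-≤ a 2^r≤p ⟩
  p ^ℕ a           ∎
  where open ≤-Reasoning

module _ (r : ℕ) .{{r≢0 : NonZero r}} where

  private
    -- The constant left for the prime factors that are at least `P`: each integer from `P` up to
    -- `2 ^ r − 1` may still cost one factor `r ^ r`.
    κ : ℕ → ℕ
    κ P = (r ^ℕ r) ^ℕ (2 ^ℕ r ∸ P)

    1≤r^r : 1 ≤ r ^ℕ r
    1≤r^r = m^n>0 r r

    instance
      r^r≢0 : NonZero (r ^ℕ r)
      r^r≢0 = ℕ.>-nonZero 1≤r^r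

    κ-suc : ∀ P → κ (suc P) ≤ κ P
    κ-suc P = ^-monoʳ-≤ (r ^ℕ r) (∸-monoʳ-≤ (2 ^ℕ r) (n≤1+n P))

    -- The choice among `a + 1` exponents of `P` is paid for by `P ^ a` alone when `P ≥ 2 ^ r`, and
    -- by `P ^ a` with one factor `r ^ r` of `κ P` otherwise.
    κ-step : ∀ P a → 2 ≤ P → suc a ^ℕ r * κ (suc P) ≤ κ P * P ^ℕ a
    κ-step P a 2≤P with P <? 2 ^ℕ r
    ... | no P≮ = ≤-trans (*-mono-≤ ([1+a]^r≤p^a r a (≮⇒≥ P≮)) (κ-suc P)) (≤-reflexive (*-comm _ (κ P)))
    ... | yes P< = begin
      suc a ^ℕ r * κ (suc P)               ≤⟨ *-monoˡ-≤ (κ (suc P)) ([1+a]^r≤r^r*2^a r a) ⟩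
      r ^ℕ r * 2 ^ℕ a * κ (suc P)          ≤⟨ *-monoˡ-≤ (κ (suc P)) (*-monoʳ-≤ (r ^ℕ r) (^-monoˡ-≤ a 2≤P)) ⟩
      r ^ℕ r * P ^ℕ a * κ (suc P)          ≡⟨ reorder (r ^ℕ r) (P ^ℕ a) (κ (suc P)) ⟩
      (r ^ℕ r) ^ℕ suc (2 ^ℕ r ∸ suc P) * P ^ℕ a ≡⟨ cong (λ j → (r ^ℕ r) ^ℕ j * P ^ℕ a) (sym (+-∸-assoc 1 P<)) ⟩
      κ P * P ^ℕ a                         ∎
      where
      open ≤-Reasoning
      reorder : ∀ x y z → x * y * z ≡ x * z * y
      reorder = solve-∀

  -- Trial division by `P`, `P + 1`, and so on. A divisor `P` of a `P`-rough number is prime, so its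
  -- full power can be split off with `covers-p^a*m`. The fuel `f` decreases as `P` grows, which
  -- preserves `n < P + f`.
  rough-cover : ∀ f P n → 2 ≤ P → 0 < n → n < P + f → P Rough n →
                ∃ λ ds → Covers ds n × length ds ^ℕ r ≤ κ P * n
  rough-cover f P 1 2≤P 0<n n< P-rough = [ 1 ] , (λ d∣1 → here (∣1⇒≡1 d∣1)) ,
    ≤-trans (≤-reflexive (^-zeroˡ r)) (≤-trans (m^n>0 (r ^ℕ r) (2 ^ℕ r ∸ P)) (≤-reflexive (sym (*-identityʳ _))))
  -- Without fuel `n < P`, whereas a `P`-rough number above 1 is at least `P`.
  rough-cover zero P n@(suc (suc _)) 2≤P 0<n n< P-rough =
    contradiction (≤-trans n< (≤-reflexive (+-identityʳ P))) (≤⇒≯ (rough⇒≤ P-rough))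
  rough-cover (suc f) P n@(suc (suc _)) 2≤P 0<n n< P-rough with P ∣? n
  ... | no P∤n =
    let ds , cov , len≤ = rough-cover f (suc P) n (m≤n⇒m≤1+n 2≤P) 0<n
                            (≤-trans n< (≤-reflexive (+-suc P f))) (∤⇒rough-suc P∤n P-rough)
    in ds , cov , ≤-trans len≤ (*-monoˡ-≤ n (κ-suc P))
  ... | yes P∣n with strip P 2≤P n 0<n
  ...   | a , zero , eq , P∤m = contradiction (trans eq (*-zeroʳ (P ^ℕ a))) λ ()
  ...   | a , m@(suc _) , eq , P∤m =
    let m∣n = divides (P ^ℕ a) eq
        ds , cov , len≤ = rough-cover f (suc P) m (m≤n⇒m≤1+n 2≤P) (s≤s z≤n)
                            (≤-<-trans (∣⇒≤ m∣n) (≤-trans n< (≤-reflexive (+-suc P f))))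
                            (∤⇒rough-suc P∤m (rough∧∣⇒rough P-rough m∣n))
        P-prime = rough∧∣⇒prime {{ℕ.n>1⇒nonTrivial 2≤P}} P-rough P∣n
    in _ , subst (Covers _) (sym eq) (covers-p^a*m P-prime a cov) , (begin
      length (cartesianProductWith _ (upTo (suc a)) ds) ^ℕ r
        ≡⟨ cong (_^ℕ r) (trans (length-cartesianProductWith _ (upTo (suc a)) ds) (cong (_* length ds) (length-upTo (suc a)))) ⟩
      (suc a * length ds) ^ℕ r          ≡⟨ ^-distrib-* (suc a) (length ds) r ⟩
      suc a ^ℕ r * length ds ^ℕ r       ≤⟨ *-monoʳ-≤ (suc a ^ℕ r) len≤ ⟩
      suc a ^ℕ r * (κ (suc P) * m)      ≡⟨ *-assoc (suc a ^ℕ r) _ m ⟨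
      suc a ^ℕ r * κ (suc P) * m        ≤⟨ *-monoˡ-≤ m (κ-step P a 2≤P) ⟩
      κ P * P ^ℕ a * m                  ≡⟨ *-assoc (κ P) _ m ⟩
      κ P * (P ^ℕ a * m)                ≡⟨ cong (κ P *_) eq ⟨
      κ P * n                           ∎)
    where open ≤-Reasoning

  divisor-bound : ∃ λ K → 0 < K × ∀ n → 0 < n → ∃ λ ds → Covers ds n × length ds ^ℕ r ≤ K * n
  divisor-bound = κ 2 , m^n>0 (r ^ℕ r) (2 ^ℕ r ∸ 2) , λ n 0<n →
    rough-cover n 2 n ≤-refl 0<n (m≤n⇒m≤1+n (n<1+n n)) 2-rough

-- Tuples with a small least common multiple

lookup∣lcms : ∀ {k} (v : Vec ℤ k) i → ℤ.∣ Vec.lookup v i ∣ ∣ ℤ.∣ lcms v ∣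
lookup∣lcms (x ∷ v) zero    = ℕ.m∣lcm[m,n] ℤ.∣ x ∣ _
lookup∣lcms (x ∷ v) (suc i) = ∣-trans (lookup∣lcms v i) (ℕ.n∣lcm[m,n] ℤ.∣ x ∣ _)

lcms>0 : ∀ {k} (v : Vec ℤ k) → (∀ i → 0 < ℤ.∣ Vec.lookup v i ∣) → 0 < ℤ.∣ lcms v ∣
lcms>0 []      v>0 = s≤s z≤n
lcms>0 (x ∷ v) v>0 = n≢0⇒n>0 λ lcm≡0 → <⇒≢ (*-mono-< (v>0 zero) (lcms>0 v (v>0 ∘ suc)))
  (trans (sym (trans (cong (gcd ℤ.∣ x ∣ ℤ.∣ lcms v ∣ *_) lcm≡0) (*-zeroʳ (gcd ℤ.∣ x ∣ ℤ.∣ lcms v ∣)))) (ℕ.gcd*lcm ℤ.∣ x ∣ ℤ.∣ lcms v ∣))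

-- The integer part of the root, found by induction: it grows by at most one when `n` does.
root : ∀ d n → ∃ λ r → r ^ℕ suc d ≤ n × n < suc r ^ℕ suc d
root d zero    = 0 , z≤n , m^n>0 1 (suc d)
root d (suc n) with root d n
... | r , r^≤n , n< with suc r ^ℕ suc d ≤? suc n
...   | no  ≰n = r , m≤n⇒m≤1+n r^≤n , ≰⇒> ≰n
...   | yes ≤n = suc r , ≤n , ≤-<-trans n< (^-monoˡ-< (suc d) (n<1+n (suc r)))

-- One `D`, the integer part of the `r`-th root of `K * ℓ`, serves all `n ≤ ℓ`. The covering list
-- depends on `n` alone, so the lists can be concatenated over many `n`.
bounded-divisor-bound : ∀ r .{{_ : NonZero r}} → ∃ λ K → 0 < K × ∀ ℓ → ∃ λ D → D ^ℕ r ≤ K * ℓ ×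
                        ∀ n → ∃ λ ds → (0 < n → n ≤ ℓ → Covers ds n) × length ds ≤ D
bounded-divisor-bound r@(suc r′) = let K , 0<K , bound = divisor-bound r in
  K , 0<K , λ ℓ → let D , D^r≤ , <D^r = root r′ (K * ℓ) in D , D^r≤ , λ n → cover K bound ℓ D <D^r n
  where
  cover : ∀ K → (∀ n → 0 < n → ∃ λ ds → Covers ds n × length ds ^ℕ r ≤ K * n) → ∀ ℓ D → K * ℓ < suc D ^ℕ r →
          ∀ n → ∃ λ ds → (0 < n → n ≤ ℓ → Covers ds n) × length ds ≤ D
  cover K bound ℓ D <D^r n with 0 <? n | n ≤? ℓ
  -- Outside the range from 1 to `ℓ` nothing has to be covered, and the empty list keeps the length
  -- bound valid for every `n`.
  ... | no n≤0  | _       = [] , (λ 0<n → contradiction 0<n n≤0) , z≤n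
  ... | yes _   | no n≰ℓ  = [] , (λ _ n≤ℓ → contradiction n≤ℓ n≰ℓ) , z≤n
  ... | yes 0<n | yes n≤ℓ = let ds , cov , len≤ = bound n 0<n in
    ds , (λ _ _ → cov) , ≮⇒≥ λ D<len → <⇒≱ <D^r
      (≤-trans (^-monoˡ-≤ r D<len) (≤-trans len≤ (*-monoʳ-≤ K n≤ℓ)))

tuples-bound : ∀ {k} (T : List (Vec ℤ k)) → Unique T → ∀ ℓ D →
  (∀ n → ∃ λ ds → (0 < n → n ≤ ℓ → Covers ds n) × length ds ≤ D) →
  (∀ {v} → v ∈ˡ T → (∀ j → ℤ.+ 0 ℤ.< Vec.lookup v j) × ℤ.∣ lcms v ∣ ≤ ℓ) →
  ∀ i A x → (∀ {v} → v ∈ˡ T → Vec.lookup v i ∈ˡ A) → 0 < x → (∀ {a} → a ∈ˡ A → x ≤ ℤ.∣ a ∣) →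
  length T * x ≤ length A * (ℓ * D ^ℕ k)
tuples-bound {k} T T! ℓ D cover T-ok i A x@(suc _) T⊆A 0<x x≤A = begin
  length T * x                          ≤⟨ *-monoˡ-≤ x (unique∧⊆⇒length≤ T! T⊆all) ⟩
  length all * x                        ≤⟨ *-monoˡ-≤ x (length-concatMap≤ pairs A (λ {a} _ →
                                             ≤-trans (length-concatMap≤ (tuples a) (upTo (ℓ / x)) (λ {c} _ → length-tuples a c))
                                               (≤-reflexive (cong (_* D ^ℕ k) (length-upTo (ℓ / x)))))) ⟩
  length A * (ℓ / x * D ^ℕ k) * x       ≡⟨ reorder (length A) (ℓ / x) (D ^ℕ k) x ⟩
  length A * (ℓ / x * x * D ^ℕ k)       ≤⟨ *-monoʳ-≤ (length A) (*-monoˡ-≤ (D ^ℕ k) (m/n*n≤m ℓ x)) ⟩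
  length A * (ℓ * D ^ℕ k)               ∎
  where
  open ≤-Reasoning
  reorder : ∀ a b c d → a * (b * c) * d ≡ a * (b * d * c)
  reorder = solve-∀

  divisors : ℕ → List ℕ
  divisors n = proj₁ (cover n)

  -- The index `c` encodes the cofactor `c + 1` of `a` in the least common multiple. It is nonzero,
  -- and `(c + 1) x ≤ (c + 1) ∣a∣ ≤ ℓ`, so `upTo (ℓ / x)` runs through all possible cofactors.
  tuples : ℤ → ℕ → List (Vec ℤ k)
  tuples a c = vectors k (map ℤ.+_ (divisors (suc c * ℤ.∣ a ∣)))

  pairs : ℤ → List (Vec ℤ k)
  pairs a = concatMap (tuples a) (upTo (ℓ / x))

  all : List (Vec ℤ k)
  all = concatMap pairs A

  length-tuples : ∀ a c → length (tuples a c) ≤ D ^ℕ k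
  length-tuples a c = ≤-trans (≤-reflexive (trans (length-vectors k _) (cong (_^ℕ k) (length-map ℤ.+_ (divisors (suc c * ℤ.∣ a ∣))))))
    (^-monoˡ-≤ k (proj₂ (proj₂ (cover (suc c * ℤ.∣ a ∣)))))

  T⊆all : T ⊆ all
  T⊆all {v} v∈T = ∈-concatMap⁺ pairs (lose (T⊆A v∈T) v∈pairs)
    where
    v>0 = proj₁ (T-ok v∈T)
    a = Vec.lookup v i
    v>0′ : ∀ j → 0 < ℤ.∣ Vec.lookup v j ∣
    v>0′ j with Vec.lookup v j | v>0 j
    ... | ℤ.+ _ | ℤ.+<+ 0<n = 0<n
    lcm>0 = lcms>0 v v>0′

    v∈tuples : ∀ c → ℤ.∣ lcms v ∣ ≡ suc c * ℤ.∣ a ∣ → v ∈ˡ tuples a c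
    v∈tuples c eq = ∈-vectors v λ j → subst (_∈ˡ map ℤ.+_ (divisors (suc c * ℤ.∣ a ∣))) (pos j)
      (∈-map⁺ ℤ.+_ (subst (λ n → Covers (divisors n) n) eq (proj₁ (proj₂ (cover _)) lcm>0 (proj₂ (T-ok v∈T)))
        (subst (ℤ.∣ Vec.lookup v j ∣ ∣_) eq (lookup∣lcms v j))))
      where
      pos : ∀ j → ℤ.+ ℤ.∣ Vec.lookup v j ∣ ≡ Vec.lookup v j
      pos j = ℤ.0≤i⇒+∣i∣≡i (ℤ.<⇒≤ (v>0 j))

    v∈pairs : v ∈ˡ pairs a
    v∈pairs with lookup∣lcms v i
    ... | divides zero    eq = contradiction (sym eq) (<⇒≢ lcm>0)
    ... | divides (suc c) eq = ∈-concatMap⁺ (tuples a) (lose (∈-upTo⁺ 1+c≤ℓ/x) (v∈tuples c eq))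
      where
      1+c≤ℓ/x : suc c ≤ ℓ / x
      1+c≤ℓ/x = subst (_≤ ℓ / x) (m*n/n≡m (suc c) x) (/-monoˡ-≤ x
        (≤-trans (*-monoʳ-≤ (suc c) (x≤A (T⊆A v∈T))) (≤-trans (≤-reflexive (sym eq)) (proj₂ (T-ok v∈T)))))

-- Order and reciprocals of rational numbers

private
  variable
    p q r u v y : ℚ

*-pos : 0ℚ ℚ.< p → 0ℚ ℚ.< q → 0ℚ ℚ.< p ℚ.* q
*-pos {p} {q} 0<p 0<q = subst (ℚ._< p ℚ.* q) (ℚ.*-zeroʳ p) (ℚ.*-monoʳ-<-pos p {{ℚ.positive 0<p}} 0<q)

*ℚ-mono-≤ : 0ℚ ℚ.≤ u → 0ℚ ℚ.≤ q → p ℚ.≤ q → u ℚ.≤ v → p ℚ.* u ℚ.≤ q ℚ.* v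
*ℚ-mono-≤ {u} {q} 0≤u 0≤q p≤q u≤v = ℚ.≤-trans
  (ℚ.*-monoʳ-≤-nonNeg u {{ℚ.nonNegative 0≤u}} p≤q)
  (ℚ.*-monoˡ-≤-nonNeg q {{ℚ.nonNegative 0≤q}} u≤v)

≤ℚ⇒≯ : p ℚ.≤ q → q ℚ.≮ p
≤ℚ⇒≯ p≤q q<p = ℚ.<-irrefl refl (ℚ.<-≤-trans q<p p≤q)

0<1 : 0ℚ ℚ.< 1ℚ
0<1 = ℚ.positive⁻¹ 1ℚ

reciprocal : 0ℚ ℚ.< p → ∃ λ i → 0ℚ ℚ.< i × i ℚ.* p ≡ 1ℚ
reciprocal {p} 0<p = (ℚ.1/ p) {{p≢0}} , ℚ.positive⁻¹ _ {{ℚ.1/pos⇒pos p {{ℚ.positive 0<p}}}} , ℚ.*-inverseˡ p {{p≢0}}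
  where
  p≢0 : ℚ.NonZero p
  p≢0 = ℚ.pos⇒nonZero p {{ℚ.positive 0<p}}

½*-pos : 0ℚ ℚ.< p → 0ℚ ℚ.< ½ ℚ.* p
½*-pos = *-pos (ℚ.positive⁻¹ ½)

½*-< : 0ℚ ℚ.< p → ½ ℚ.* p ℚ.< p
½*-< {p} 0<p = subst (½ ℚ.* p ℚ.<_) (ℚ.*-identityˡ p)
  (ℚ.*-monoˡ-<-pos p {{ℚ.positive 0<p}} {½} {1ℚ} (ℚ.*<* (ℤ.+<+ (s≤s (s≤s z≤n)))))

-- Powers of rationals

^ℚ-pos : ∀ n → 0ℚ ℚ.< p → 0ℚ ℚ.< p ^ℚ n
^ℚ-pos zero    0<p = 0<1
^ℚ-pos (suc n) 0<p = *-pos 0<p (^ℚ-pos n 0<p)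

^ℚ-nonNeg : ∀ n → 0ℚ ℚ.≤ p → 0ℚ ℚ.≤ p ^ℚ n
^ℚ-nonNeg zero    0≤p = ℚ.<⇒≤ 0<1
^ℚ-nonNeg {p} (suc n) 0≤p = subst (ℚ._≤ p ^ℚ suc n) (ℚ.*-zeroʳ p)
  (ℚ.*-monoˡ-≤-nonNeg p {{ℚ.nonNegative 0≤p}} (^ℚ-nonNeg n 0≤p))

^ℚ-mono : ∀ n → 0ℚ ℚ.≤ p → p ℚ.≤ q → p ^ℚ n ℚ.≤ q ^ℚ n
^ℚ-mono zero    0≤p p≤q = ℚ.≤-refl
^ℚ-mono (suc n) 0≤p p≤q = *ℚ-mono-≤ (^ℚ-nonNeg n 0≤p) (ℚ.≤-trans 0≤p p≤q) p≤q (^ℚ-mono n 0≤p p≤q)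

^ℚ-mono-< : ∀ n → 0ℚ ℚ.≤ p → p ℚ.< q → p ^ℚ suc n ℚ.< q ^ℚ suc n
^ℚ-mono-< {p} {q} n 0≤p p<q = ℚ.≤-<-trans
  (ℚ.*-monoˡ-≤-nonNeg p {{ℚ.nonNegative 0≤p}} (^ℚ-mono n 0≤p (ℚ.<⇒≤ p<q)))
  (ℚ.*-monoˡ-<-pos (q ^ℚ n) {{ℚ.positive (^ℚ-pos n (ℚ.≤-<-trans 0≤p p<q))}} p<q)

^ℚ-cancel-≤ : ∀ n → 0ℚ ℚ.≤ q → p ^ℚ suc n ℚ.≤ q ^ℚ suc n → p ℚ.≤ q
^ℚ-cancel-≤ {q} {p} n 0≤q p^≤q^ with p ℚ.≤? q
... | yes p≤q = p≤q
... | no  p≰q = contradiction (^ℚ-mono-< n 0≤q (ℚ.≰⇒> p≰q)) (≤ℚ⇒≯ p^≤q^)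

1^ℚ : ∀ n → 1ℚ ^ℚ n ≡ 1ℚ
1^ℚ zero    = refl
1^ℚ (suc n) = trans (ℚ.*-identityˡ _) (1^ℚ n)

1≤^ℚ : ∀ n → 1ℚ ℚ.≤ p → 1ℚ ℚ.≤ p ^ℚ n
1≤^ℚ {p} n 1≤p = subst (ℚ._≤ p ^ℚ n) (1^ℚ n) (^ℚ-mono n (ℚ.<⇒≤ 0<1) 1≤p)

^ℚ≤1 : ∀ n → 0ℚ ℚ.≤ p → p ℚ.≤ 1ℚ → p ^ℚ n ℚ.≤ 1ℚ
^ℚ≤1 {p} n 0≤p p≤1 = subst (p ^ℚ n ℚ.≤_) (1^ℚ n) (^ℚ-mono n 0≤p p≤1)

^ℚ-monoʳ : ∀ {m n} → 1ℚ ℚ.≤ p → m ≤ n → p ^ℚ m ℚ.≤ p ^ℚ n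
^ℚ-monoʳ {n = n} 1≤p z≤n       = 1≤^ℚ n 1≤p
^ℚ-monoʳ {p}     1≤p (s≤s m≤n) =
  ℚ.*-monoˡ-≤-nonNeg p {{ℚ.nonNegative (ℚ.≤-trans (ℚ.<⇒≤ 0<1) 1≤p)}} (^ℚ-monoʳ 1≤p m≤n)

^ℚ-comm : ∀ p m n → (p ^ℚ m) ^ℚ n ≡ (p ^ℚ n) ^ℚ m
^ℚ-comm p m n = trans (Exp.^-assocʳ p m n) (trans (cong (p ^ℚ_) (ℕ.*-comm m n)) (sym (Exp.^-assocʳ p n m)))

-- Natural numbers as rationals, and rational roots

ι : ℕ → ℚ
ι n = ℤ.+ n ℚ./ 1

ι-mkℚ : ∀ n → ι n ≡ mkℚ (ℤ.+ n) 0 (Coprime.sym (1-coprimeTo n))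
ι-mkℚ n = ℚ.↥p/↧p≡p (mkℚ (ℤ.+ n) 0 _)

ι-mono : ∀ {m n} → m ≤ n → ι m ℚ.≤ ι n
ι-mono {m} {n} m≤n rewrite ι-mkℚ m | ι-mkℚ n = ℚ.*≤* (ℤ.*-monoʳ-≤-nonNeg (ℤ.+ 1) (ℤ.+≤+ m≤n))

ι-* : ∀ m n → ι (m * n) ≡ ι m ℚ.* ι n
ι-* m n rewrite ι-mkℚ m | ι-mkℚ n = cong (ℚ._/ 1) (ℤ.pos-* m n)

ι-^ : ∀ m n → ι (m ^ℕ n) ≡ ι m ^ℚ n
ι-^ m zero    = refl
ι-^ m (suc n) = trans (ι-* m (m ^ℕ n)) (cong (ι m ℚ.*_) (ι-^ m n))

ι-pos : ∀ n → 0 < n → 0ℚ ℚ.< ι n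
ι-pos (suc n) _ = ℚ.positive⁻¹ (ι (suc n)) {{ℚ.normalize-pos (suc n) 1}}

-- Write `u = (m + 1) E^d / E^(d + 1)` with `E = e + 1` its denominator, let `R` be the integer root
-- of the numerator, and take `p = R / E`. Since `R ≥ 1`, the next integer `R + 1` is at most `2 R`,
-- whence the factor 2.
rational-root : ∀ d → 0ℚ ℚ.< u → ∃ λ p → 0ℚ ℚ.< p × p ^ℚ suc d ℚ.≤ u × u ℚ.≤ (ι 2 ℚ.* p) ^ℚ suc d
rational-root {u@(mkℚ (ℤ.+ zero) _ _)} d 0<u = contradiction (ℚ.positive 0<u) λ ()
rational-root {u@(mkℚ ℤ.-[1+ _ ] _ _)} d 0<u = contradiction (ℚ.positive 0<u) λ ()
rational-root {u@(mkℚ (ℤ.+ suc m) e c)} d 0<u with root d (suc m * suc e ^ℕ d)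
... | zero  , _  , <1 = contradiction (subst (suc m * suc e ^ℕ d <_) (ℕ.^-zeroˡ (suc d)) <1)
                          (ℕ.≤⇒≯ (ℕ.*-mono-≤ (s≤s (z≤n {m})) (ℕ.m^n>0 (suc e) d)))
... | R@(suc R′) , R^≤ , <R^ = ι R ℚ.* i , *-pos (ι-pos R (s≤s z≤n)) 0<i , lower , upper
  where
  E = ι (suc e)
  0<E : 0ℚ ℚ.< E
  0<E = ι-pos (suc e) (s≤s z≤n)
  i = proj₁ (reciprocal 0<E)
  0<i = proj₁ (proj₂ (reciprocal 0<E))
  iE≡1 : i ℚ.* E ≡ 1ℚ
  iE≡1 = proj₂ (proj₂ (reciprocal 0<E))
  0<E^ = ^ℚ-pos (suc d) 0<E

  uE : u ℚ.* E ≡ ι (suc m)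
  uE = ℚ.toℚᵘ-injective (ℚᵘ.≃-trans (ℚ.toℚᵘ-homo-* u E) (ℚᵘ.≃-trans
    (ℚᵘ.*-congˡ {ℚ.toℚᵘ u} (ℚ.toℚᵘ-fromℚᵘ (mkℚᵘ (ℤ.+ suc e) 0)))
    (ℚᵘ.≃-trans (*≡* (ℤ*-lemma (ℤ.+ suc m) (ℤ.+ suc e))) (ℚᵘ.≃-sym (ℚ.toℚᵘ-fromℚᵘ (mkℚᵘ (ℤ.+ suc m) 0))))))
    where
    ℤ*-lemma : ∀ a b → (a ℤ.* b) ℤ.* ℤ.+ 1 ≡ a ℤ.* (b ℤ.* ℤ.+ 1)
    ℤ*-lemma a b = ℤ.*-assoc a b (ℤ.+ 1)

  uE^ : u ℚ.* E ^ℚ suc d ≡ ι (suc m * suc e ^ℕ d)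
  uE^ = trans (sym (ℚ.*-assoc u E (E ^ℚ d))) (trans (cong₂ ℚ._*_ uE (sym (ι-^ (suc e) d))) (sym (ι-* (suc m) (suc e ^ℕ d))))

  scale : ∀ k → (k ℚ.* i) ^ℚ suc d ℚ.* E ^ℚ suc d ≡ k ^ℚ suc d
  scale k = trans (sym (Exp.^-distrib-* (k ℚ.* i) E (suc d)))
    (cong (_^ℚ suc d) (trans (ℚ.*-assoc k i E) (trans (cong (k ℚ.*_) iE≡1) (ℚ.*-identityʳ k))))

  lower : (ι R ℚ.* i) ^ℚ suc d ℚ.≤ u
  lower = ℚ.*-cancelʳ-≤-pos (E ^ℚ suc d) {{ℚ.positive 0<E^}}
    (subst₂ ℚ._≤_ (trans (ι-^ R (suc d)) (sym (scale (ι R)))) (sym uE^) (ι-mono R^≤))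

  upper : u ℚ.≤ (ι 2 ℚ.* (ι R ℚ.* i)) ^ℚ suc d
  upper = ℚ.*-cancelʳ-≤-pos (E ^ℚ suc d) {{ℚ.positive 0<E^}}
    (subst₂ ℚ._≤_ (sym uE^)
      (trans (ι-^ (2 * R) (suc d)) (trans (sym (scale (ι (2 * R))))
        (cong (λ w → w ^ℚ suc d ℚ.* E ^ℚ suc d) (trans (cong (ℚ._* i) (ι-* 2 R)) (ℚ.*-assoc (ι 2) (ι R) i)))))
      (ι-mono (ℕ.≤-trans (ℕ.<⇒≤ <R^) (ℕ.^-monoˡ-≤ (suc d) 1+R≤2R))))
    where
    1+R≤2R : suc R ≤ 2 * R
    1+R≤2R = ℕ.≤-trans (ℕ.+-monoˡ-≤ R (s≤s (z≤n {R′}))) (ℕ.≤-reflexive (cong (R +_) (sym (ℕ.+-identityʳ R))))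

-- Bounds for real operations

-- Roundedness moves the witness `a` up to `b`. Were `b ≤ 0`, rationals between `a` and `b` would be
-- negative and yet exceed `a`, which bounds all negative rationals.
pos-element : ∀ (x : ℝ⁺) → ∃ λ a → 0ℚ ℚ.< a × a ◃ value x
pos-element x with ℝ⁺.positive x
... | a , 0⊴a , a◃x with rounded (value x) a◃x
... | b , a<b , b◃x with b ℚ.≤? 0ℚ
... | no b≰0 = b , ℚ.≰⇒> b≰0 , b◃x
... | yes b≤0 = let m , a<m , m<b = ℚ.<-dense a<b in
  contradiction a<m (≤ℚ⇒≯ (0⊴a (ℚ.<-≤-trans m<b b≤0)))

⊴-pos : ∀ (x : ℝ⁺) → value x ⊴ u → 0ℚ ℚ.< u
⊴-pos x x⊴u = let a , 0<a , a◃x = pos-element x in ℚ.<-≤-trans 0<a (x⊴u a◃x)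

-- With positive lower ends the smallest of the four corners is `a * b`, whatever the upper ends
-- are.
*-◃ : ∀ x y {a b} → 0ℚ ℚ.< a → a ◃ x → 0ℚ ℚ.< b → b ◃ y → q ℚ.< a ℚ.* b → q ◃ x *ᴿ y
*-◃ {q} x y {a} {b} 0<a a◃x 0<b b◃y q<ab =
  let a′ , x⊴a′ = bounded x ; b′ , y⊴b′ = bounded y
      a≤a′ = x⊴a′ a◃x ; b≤b′ = y⊴b′ b◃y
      0≤a = ℚ.<⇒≤ 0<a ; 0≤b = ℚ.<⇒≤ 0<b
      0≤a′ = ℚ.≤-trans 0≤a a≤a′ ; 0≤b′ = ℚ.≤-trans 0≤b b≤b′
  in a , a′ , b , b′ , (a◃x , x⊴a′) , (b◃y , y⊴b′) , ℚ.<-≤-trans q<ab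
    (ℚ.⊓-glb (ℚ.⊓-glb ℚ.≤-refl (*ℚ-mono-≤ 0≤b 0≤a ℚ.≤-refl b≤b′))
             (ℚ.⊓-glb (*ℚ-mono-≤ 0≤b 0≤a′ a≤a′ ℚ.≤-refl) (*ℚ-mono-≤ 0≤b 0≤a′ a≤a′ b≤b′)))

-- If a lower end is at most 0, some corner is at most 0 and hence below `u * v`; otherwise the
-- corner `a * b` is compared factor by factor.
*-⊴ : ∀ (x y : ℝ⁺) → value x ⊴ u → value y ⊴ v → value x *ᴿ value y ⊴ u ℚ.* v
*-⊴ {u} {v} x y x⊴u y⊴v {q} (a , a′ , b , b′ , (a◃x , x⊴a′) , (b◃y , y⊴b′) , q<) = ℚ.≤-trans (ℚ.<⇒≤ q<) corner
  where
  0≤u = ℚ.<⇒≤ (⊴-pos x x⊴u)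
  0≤uv : 0ℚ ℚ.≤ u ℚ.* v
  0≤uv = ℚ.<⇒≤ (*-pos (⊴-pos x x⊴u) (⊴-pos y y⊴v))
  0≤a′ = ℚ.<⇒≤ (⊴-pos x x⊴a′)
  0≤b′ = ℚ.<⇒≤ (⊴-pos y y⊴b′)

  corner : corners⊓ a a′ b b′ ℚ.≤ u ℚ.* v
  corner with ℚ.≤-total a 0ℚ | ℚ.≤-total b 0ℚ
  ... | inj₁ a≤0 | _ = ℚ.≤-trans (ℚ.≤-trans (ℚ.p⊓q≤p _ _) (ℚ.p⊓q≤q (a ℚ.* b) _))
    (ℚ.≤-trans (subst (a ℚ.* b′ ℚ.≤_) (ℚ.*-zeroˡ b′) (ℚ.*-monoʳ-≤-nonNeg b′ {{ℚ.nonNegative 0≤b′}} a≤0)) 0≤uv)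
  ... | inj₂ 0≤a | inj₁ b≤0 = ℚ.≤-trans (ℚ.≤-trans (ℚ.p⊓q≤q ((a ℚ.* b) ℚ.⊓ (a ℚ.* b′)) _) (ℚ.p⊓q≤p _ _))
    (ℚ.≤-trans (subst (a′ ℚ.* b ℚ.≤_) (ℚ.*-zeroʳ a′) (ℚ.*-monoˡ-≤-nonNeg a′ {{ℚ.nonNegative 0≤a′}} b≤0)) 0≤uv)
  ... | inj₂ 0≤a | inj₂ 0≤b = ℚ.≤-trans (ℚ.≤-trans (ℚ.p⊓q≤p _ _) (ℚ.p⊓q≤p _ _))
    (*ℚ-mono-≤ 0≤b 0≤u (x⊴u a◃x) (y⊴v b◃y))

⁻¹-◃ : ∀ (x : ℝ⁺) → value x ⊴ u → 0ℚ ℚ.≤ r → r ℚ.* u ℚ.≤ 1ℚ → q ℚ.< r → q ◃ value (x ⁻¹)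
⁻¹-◃ {r = r} x x⊴u 0≤r ru≤1 q<r = r , q<r , λ _ a◃x →
  ℚ.≤-trans (ℚ.*-monoˡ-≤-nonNeg r {{ℚ.nonNegative 0≤r}} (x⊴u a◃x)) ru≤1

-- If `r > 1`, any `a` strictly between `1 / r` and 1 lies below `x` and violates `r * a ≤ 1`.
⁻¹-⊴1 : ∀ (x : ℝ⁺) → 1ᴿ ≤ᴿ value x → value (x ⁻¹) ⊴ 1ℚ
⁻¹-⊴1 x 1≤x {q} (r , q<r , rx≤1) with r ℚ.≤? 1ℚ
... | yes r≤1 = ℚ.≤-trans (ℚ.<⇒≤ q<r) r≤1
... | no  r≰1 =
  let 1<r = ℚ.≰⇒> r≰1
      0<r = ℚ.<-trans 0<1 1<r
      i , 0<i , ir≡1 = reciprocal 0<r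
      i<1 = subst (ℚ._< 1ℚ) (ℚ.*-identityʳ i) (subst (i ℚ.* 1ℚ ℚ.<_) ir≡1 (ℚ.*-monoʳ-<-pos i {{ℚ.positive 0<i}} 1<r))
      a , i<a , a<1 = ℚ.<-dense i<1
      1<ra = subst (ℚ._< r ℚ.* a) (trans (ℚ.*-comm r i) ir≡1) (ℚ.*-monoʳ-<-pos r {{ℚ.positive 0<r}} i<a)
  in contradiction 1<ra (≤ℚ⇒≯ (rx≤1 (ℚ.<-trans 0<i i<a) (1≤x a<1)))

-- For 0 ≤ q < 1, both factors exceed a = (1 + q) / 2 < 1, and a² − q = ((1 − q) / 2)² > 0.
1≤* : ∀ x y → 1ᴿ ≤ᴿ x → 1ᴿ ≤ᴿ y → 1ᴿ ≤ᴿ x *ᴿ y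
1≤* x y 1≤x 1≤y {q} q<1 with ℚ.≤-total q 0ℚ
... | inj₁ q≤0 = *-◃ x y (ℚ.positive⁻¹ ½) (1≤x ½<1) (ℚ.positive⁻¹ ½) (1≤y ½<1) (ℚ.≤-<-trans q≤0 (*-pos (ℚ.positive⁻¹ ½) (ℚ.positive⁻¹ ½)))
  where ½<1 = ½*-< 0<1
... | inj₂ 0≤q = *-◃ x y 0<a (1≤x a<1) 0<a (1≤y a<1) q<a²
  where
  open +-*-Solver
  a = ½ ℚ.* (1ℚ ℚ.+ q)
  h = ½ ℚ.* (1ℚ ℚ.- q)
  0<a : 0ℚ ℚ.< a
  0<a = ½*-pos (ℚ.<-≤-trans 0<1 (subst (ℚ._≤ 1ℚ ℚ.+ q) (ℚ.+-identityʳ 1ℚ) (ℚ.+-monoʳ-≤ 1ℚ 0≤q)))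
  a<1 : a ℚ.< 1ℚ
  a<1 = subst (a ℚ.<_) refl (ℚ.*-monoʳ-<-pos ½ (ℚ.+-monoʳ-< 1ℚ q<1))
  0<h : 0ℚ ℚ.< h
  0<h = ½*-pos (subst (ℚ._< 1ℚ ℚ.- q) (ℚ.+-inverseʳ q) (ℚ.+-monoˡ-< (ℚ.- q) q<1))
  a²≡ : a ℚ.* a ≡ q ℚ.+ h ℚ.* h
  a²≡ = solve 1 (λ q → (con ½ :* (con 1ℚ :+ q)) :* (con ½ :* (con 1ℚ :+ q)) := q :+ (con ½ :* (con 1ℚ :+ :- q)) :* (con ½ :* (con 1ℚ :+ :- q))) refl q
  q<a² : q ℚ.< a ℚ.* a
  q<a² = subst₂ ℚ._<_ (ℚ.+-identityʳ q) (sym a²≡) (ℚ.+-monoʳ-< q (*-pos 0<h 0<h))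

1≤∏⁺ : ∀ {k} (X : Fin k → ℝ⁺) → (∀ i → 1ᴿ ≤ᴿ value (X i)) → 1ᴿ ≤ᴿ value (∏⁺ X)
1≤∏⁺ {zero}  X 1≤X q◃ = q◃
1≤∏⁺ {suc k} X 1≤X {q} = 1≤* (value (X zero)) (value (∏⁺ (X ∘ suc))) (λ {q} → 1≤X zero {q}) (λ {q} → 1≤∏⁺ (X ∘ suc) (λ i {q} → 1≤X (suc i) {q}) {q}) {q}

∏⁺-⊴ : ∀ {k} (X : Fin k → ℝ⁺) (x : Fin k → ℕ) → (∀ i → value (X i) ⊴ ι (x i)) → value (∏⁺ X) ⊴ ι (∏ℕ x)
∏⁺-⊴ {zero}  X x X⊴x q<1 = ℚ.<⇒≤ q<1
∏⁺-⊴ {suc k} X x X⊴x {q} q◃ = subst (q ℚ.≤_) (sym (ι-* (x zero) (∏ℕ (x ∘ suc))))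
  (*-⊴ (X zero) (∏⁺ (X ∘ suc)) (X⊴x zero) (∏⁺-⊴ (X ∘ suc) (x ∘ suc) (X⊴x ∘ suc)) q◃)

-- Bounds for real powers

-- Two fractions for one exponent give the same condition: raise to the power `d′ + 1`, then cancel
-- the power `d + 1`. It is needed because `powℚ` reads its exponent in lowest terms.
rescale : ∀ {m m′ d d′} → 0ℚ ℚ.≤ p → 0ℚ ℚ.≤ y → m′ * suc d ≡ m * suc d′ → p ^ℚ suc d ℚ.≤ y ^ℚ m → p ^ℚ suc d′ ℚ.≤ y ^ℚ m′
rescale {p} {y} {m} {m′} {d} {d′} 0≤p 0≤y eq p^≤y^ = ^ℚ-cancel-≤ d (^ℚ-nonNeg m′ 0≤y) (begin
  (p ^ℚ suc d′) ^ℚ suc d   ≡⟨ ^ℚ-comm p (suc d′) (suc d) ⟩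
  (p ^ℚ suc d) ^ℚ suc d′   ≤⟨ ^ℚ-mono (suc d′) (^ℚ-nonNeg (suc d) 0≤p) p^≤y^ ⟩
  (y ^ℚ m) ^ℚ suc d′       ≡⟨ Exp.^-assocʳ y m (suc d′) ⟩
  y ^ℚ (m * suc d′)        ≡⟨ cong (y ^ℚ_) eq ⟨
  y ^ℚ (m′ * suc d)        ≡⟨ Exp.^-assocʳ y m′ (suc d) ⟨
  (y ^ℚ m′) ^ℚ suc d       ∎)
  where open ℚ.≤-Reasoning

powℚ-◃ : ∀ (x : ℝ⁺) t m d → ℚ.toℚᵘ t ℚᵘ.≃ mkℚᵘ (ℤ.+ m) d → 0ℚ ℚ.< p → 0ℚ ℚ.< y → y ◃ value x →
         p ^ℚ suc d ℚ.≤ y ^ℚ m → q ℚ.< p → q ◃ value (powℚ x t)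
powℚ-◃ {p} {y} x (mkℚ (ℤ.+ m′) d′ _) m d (*≡* eq) 0<p 0<y y◃x p^≤y^ q<p =
  p , y , q<p , 0<p , 0<y , y◃x , rescale {m = m} {m′} (ℚ.<⇒≤ 0<p) (ℚ.<⇒≤ 0<y)
    (ℤ.+-injective (trans (ℤ.pos-* m′ (suc d)) (trans eq (sym (ℤ.pos-* m (suc d′)))))) p^≤y^
powℚ-◃ x (mkℚ ℤ.-[1+ m′ ] d′ _) m d (*≡* eq) = contradiction (trans eq (sym (ℤ.pos-* m (suc d′)))) λ ()

powℚ-◃⁻ : ∀ (x : ℝ⁺) t m d → ℚ.toℚᵘ t ℚᵘ.≃ mkℚᵘ ℤ.-[1+ m ] d → 0ℚ ℚ.< p → 0ℚ ℚ.< y → y ◃ value (x ⁻¹) →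
          p ^ℚ suc d ℚ.≤ y ^ℚ suc m → q ℚ.< p → q ◃ value (powℚ x t)
powℚ-◃⁻ {p} {y} x (mkℚ ℤ.-[1+ m′ ] d′ _) m d (*≡* eq) 0<p 0<y y◃ p^≤y^ q<p =
  p , y , q<p , 0<p , 0<y , y◃ , rescale {m = suc m} {suc m′} (ℚ.<⇒≤ 0<p) (ℚ.<⇒≤ 0<y)
    (cong suc (ℤ.-[1+-injective eq)) p^≤y^
powℚ-◃⁻ x (mkℚ (ℤ.+ m′) d′ _) m d (*≡* eq) = contradiction (trans (ℤ.pos-* m′ (suc d)) eq) λ ()

-- An element of the power comes with a rational `t < 1 / (k + 1)`. For `t = m / (d + 1)` this says
-- `(k + 1) m ≤ d + 1`, so `p ^ (d + 1) ≤ v ^ ((k + 1) m) ≤ v ^ (d + 1)` as `v ≥ 1`.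
^-⊴ : ∀ (x : ℝ⁺) k → 1ᴿ ≤ᴿ value x → value x ⊴ u → 1ℚ ℚ.≤ v → u ℚ.≤ v ^ℚ suc k →
      value (x ^ fromℚ (ℤ.+ 1 ℚ./ suc k)) ⊴ v
^-⊴ {u} {v} x k 1≤x x⊴u 1≤v u≤v^ {q} (mkℚ (ℤ.+ m) d c , _ , t<s , _ , (p , y , q<p , 0<p , 0<y , y◃x , p^≤y^) , _) =
  ℚ.≤-trans (ℚ.<⇒≤ q<p) (^ℚ-cancel-≤ d (ℚ.≤-trans (ℚ.<⇒≤ 0<1) 1≤v) (begin
    p ^ℚ suc d          ≤⟨ p^≤y^ ⟩
    y ^ℚ m              ≤⟨ ^ℚ-mono m (ℚ.<⇒≤ 0<y) (ℚ.≤-trans (x⊴u y◃x) u≤v^) ⟩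
    (v ^ℚ suc k) ^ℚ m   ≡⟨ Exp.^-assocʳ v (suc k) m ⟩
    v ^ℚ (suc k * m)    ≤⟨ ^ℚ-monoʳ 1≤v km≤d ⟩
    v ^ℚ suc d          ∎))
  where
  open ℚ.≤-Reasoning
  km≤d : suc k * m ≤ suc d
  km≤d with ℚᵘ.<-respʳ-≃ (ℚ.toℚᵘ-fromℚᵘ (mkℚᵘ (ℤ.+ 1) k)) (ℚ.toℚᵘ-mono-< t<s)
  ... | ℚᵘ.*<* lt = ℕ.≤-trans (ℕ.≤-reflexive (ℕ.*-comm (suc k) m))
    (ℕ.≤-trans (ℤ.drop‿+≤+ (ℤ.≤-trans (ℤ.≤-reflexive (ℤ.pos-* m (suc k))) (ℤ.<⇒≤ lt))) (ℕ.≤-reflexive (ℕ.*-identityˡ (suc d))))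
-- For negative `t` the base `y` lies below `x ⁻¹` and is at most 1, so `p ≤ 1 ≤ v`.
^-⊴ x k 1≤x x⊴u 1≤v u≤v^ (mkℚ ℤ.-[1+ m ] d _ , _ , _ , _ , (p , y , q<p , 0<p , 0<y , y◃ , p^≤y^) , _) =
  ℚ.≤-trans (ℚ.<⇒≤ q<p) (ℚ.≤-trans (^ℚ-cancel-≤ d (ℚ.<⇒≤ 0<1) (ℚ.≤-trans p^≤y^
    (ℚ.≤-trans (^ℚ≤1 (suc m) (ℚ.<⇒≤ 0<y) (⁻¹-⊴1 x (λ {q} → 1≤x {q}) y◃)) (ℚ.≤-reflexive (sym (1^ℚ (suc d))))))) 1≤v)

-- Reduction to integers

minimum : ∀ {A : Set} (f : A → ℕ) (xs : List A) → 0 < length xs → ∃ λ x → x ∈ˡ xs × ∀ {y} → y ∈ˡ xs → f x ≤ f y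
minimum f (x ∷ xs) _ = argmin f x xs , m∈ , λ where
    (here refl) → f[argmin]≤f[⊤] {f = f} x xs
    (there y∈)  → All.lookup (f[argmin]≤f[xs] {f = f} x xs) y∈
  where
  m∈ : argmin f x xs ∈ˡ x ∷ xs
  m∈ with argmin-sel f x xs
  ... | inj₁ eq = here eq
  ... | inj₂ m∈ = there m∈

maximum : ∀ {A : Set} (f : A → ℕ) (xs : List A) → 0 < length xs → ∃ λ x → x ∈ˡ xs × ∀ {y} → y ∈ˡ xs → f y ≤ f x
maximum f (x ∷ xs) _ = argmax f x xs , m∈ , λ where
    (here refl) → f[⊥]≤f[argmax] {f = f} x xs
    (there y∈)  → All.lookup (f[xs]≤f[argmax] {f = f} x xs) y∈
  where
  m∈ : argmax f x xs ∈ˡ x ∷ xs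
  m∈ with argmax-sel f x xs
  ... | inj₁ eq = here eq
  ... | inj₂ m∈ = there m∈

∏ℕ-pos : ∀ {k} (x : Fin k → ℕ) → (∀ i → 0 < x i) → 0 < ∏ℕ x
∏ℕ-pos {zero}  x 0<x = s≤s z≤n
∏ℕ-pos {suc k} x 0<x = ℕ.*-mono-< (0<x zero) (∏ℕ-pos (x ∘ suc) (0<x ∘ suc))

∏ℕ-pos⁻¹ : ∀ {k} (x : Fin k → ℕ) → 0 < ∏ℕ x → ∀ i → 0 < x i
∏ℕ-pos⁻¹ x 0<∏ zero    = ℕ.n≢0⇒n>0 λ x₀≡0 → ℕ.<⇒≢ 0<∏ (sym (cong (_* ∏ℕ (x ∘ suc)) x₀≡0))
∏ℕ-pos⁻¹ x 0<∏ (suc i) = ∏ℕ-pos⁻¹ (x ∘ suc) (ℕ.n≢0⇒n>0 λ ∏≡0 → ℕ.<⇒≢ 0<∏ (sym (trans (cong (x zero *_) ∏≡0) (ℕ.*-zeroʳ (x zero))))) i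

∏ℕ-mono : ∀ {k} (x a : Fin k → ℕ) t b → (∀ i → t * x i ≤ a i * b) → t ^ℕ k * ∏ℕ x ≤ ∏ℕ a * b ^ℕ k
∏ℕ-mono {zero}  x a t b tx≤ab = ℕ.≤-refl
∏ℕ-mono {suc k} x a t b tx≤ab = begin
  t * t ^ℕ k * (x zero * ∏ℕ (x ∘ suc))     ≡⟨ ℕ.[m*n]*[o*p]≡[m*o]*[n*p] t (t ^ℕ k) (x zero) _ ⟩
  t * x zero * (t ^ℕ k * ∏ℕ (x ∘ suc))     ≤⟨ ℕ.*-mono-≤ (tx≤ab zero) (∏ℕ-mono (x ∘ suc) (a ∘ suc) t b (tx≤ab ∘ suc)) ⟩
  a zero * b * (∏ℕ (a ∘ suc) * b ^ℕ k)     ≡⟨ ℕ.[m*n]*[o*p]≡[m*o]*[n*p] (a zero) b (∏ℕ (a ∘ suc)) _ ⟩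
  a zero * ∏ℕ (a ∘ suc) * (b * b ^ℕ k)     ∎
  where open ℕ.≤-Reasoning

-- The product of the `k` coordinate bounds, raised to the power `S`, collects the divisor factors
-- into `D ^ (k * k * S)`, which costs a single factor `K * ℓ`. The excess `ℓ` is harmless for large
-- `S`, after the root is taken.
powers-bound : ∀ {k} (x a : Fin k → ℕ) {t t′ ℓ D K} S → (∀ i → t * x i ≤ a i * (ℓ * D ^ℕ k)) → t′ ≤ t →
          D ^ℕ (k * k * S) ≤ K * ℓ → t′ ^ℕ (k * S) * ∏ℕ x ^ℕ S ≤ ∏ℕ a ^ℕ S * (K * ℓ ^ℕ suc (k * S))
powers-bound {k} x a {t} {t′} {ℓ} {D} {K} S tx≤ t′≤t D≤ = begin
  t′ ^ℕ (k * S) * ∏ℕ x ^ℕ S                    ≤⟨ ℕ.*-monoˡ-≤ (∏ℕ x ^ℕ S) (ℕ.^-monoˡ-≤ (k * S) t′≤t) ⟩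
  t ^ℕ (k * S) * ∏ℕ x ^ℕ S                     ≡⟨ cong (_* ∏ℕ x ^ℕ S) (ℕ.^-*-assoc t k S) ⟨
  (t ^ℕ k) ^ℕ S * ∏ℕ x ^ℕ S                    ≡⟨ ^-distrib-* (t ^ℕ k) (∏ℕ x) S ⟨
  (t ^ℕ k * ∏ℕ x) ^ℕ S                         ≤⟨ ℕ.^-monoˡ-≤ S (∏ℕ-mono x a t (ℓ * D ^ℕ k) tx≤) ⟩
  (∏ℕ a * (ℓ * D ^ℕ k) ^ℕ k) ^ℕ S              ≡⟨ ^-distrib-* (∏ℕ a) _ S ⟩
  ∏ℕ a ^ℕ S * ((ℓ * D ^ℕ k) ^ℕ k) ^ℕ S         ≡⟨ cong (∏ℕ a ^ℕ S *_) (ℕ.^-*-assoc _ k S) ⟩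
  ∏ℕ a ^ℕ S * (ℓ * D ^ℕ k) ^ℕ (k * S)          ≡⟨ cong (∏ℕ a ^ℕ S *_) (^-distrib-* ℓ (D ^ℕ k) (k * S)) ⟩
  ∏ℕ a ^ℕ S * (ℓ ^ℕ (k * S) * (D ^ℕ k) ^ℕ (k * S))  ≡⟨ cong (λ e → ∏ℕ a ^ℕ S * (ℓ ^ℕ (k * S) * e)) (trans (ℕ.^-*-assoc D k (k * S)) (cong (D ^ℕ_) (sym (ℕ.*-assoc k k S)))) ⟩
  ∏ℕ a ^ℕ S * (ℓ ^ℕ (k * S) * D ^ℕ (k * k * S))     ≤⟨ ℕ.*-monoʳ-≤ (∏ℕ a ^ℕ S) (ℕ.*-monoʳ-≤ (ℓ ^ℕ (k * S)) D≤) ⟩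
  ∏ℕ a ^ℕ S * (ℓ ^ℕ (k * S) * (K * ℓ))         ≡⟨ cong (∏ℕ a ^ℕ S *_) (reorder (ℓ ^ℕ (k * S)) K ℓ) ⟩
  ∏ℕ a ^ℕ S * (K * (ℓ * ℓ ^ℕ (k * S)))         ∎
  where
  open ℕ.≤-Reasoning
  reorder : ∀ x y z → x * (y * z) ≡ y * (z * x)
  reorder = solve-∀

lcms-+ : ∀ {k} (v : Vec ℤ k) → lcms v ≡ ℤ.+ ℤ.∣ lcms v ∣
lcms-+ []      = refl
lcms-+ (_ ∷ _) = refl

-- Evaluation of the bound

2*½* : ∀ p → ι 2 ℚ.* (½ ℚ.* p) ≡ p
2*½* p = trans (sym (ℚ.*-assoc (ι 2) ½ p)) (ℚ.*-identityˡ p)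

^-halve : ∀ p n → p ^ℚ n ≡ ι 2 ^ℚ n ℚ.* (½ ℚ.* p) ^ℚ n
^-halve p n = trans (cong (_^ℚ n) (sym (2*½* p))) (Exp.^-distrib-* (ι 2) (½ ℚ.* p) n)

-- The exponents of a real power are only known between t and t + 1, which for y ≥ ½ costs a factor 2.
½p^≤y^ : ∀ m d → 0ℚ ℚ.≤ p → ½ ℚ.≤ y → p ^ℚ suc d ℚ.≤ y ^ℚ m → (½ ℚ.* p) ^ℚ suc d ℚ.≤ y ^ℚ (m + suc d)
½p^≤y^ {p} {y} m d 0≤p ½≤y p^≤y^ = begin
  (½ ℚ.* p) ^ℚ suc d             ≡⟨ Exp.^-distrib-* ½ p (suc d) ⟩
  ½ ^ℚ suc d ℚ.* p ^ℚ suc d      ≡⟨ ℚ.*-comm (½ ^ℚ suc d) _ ⟩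
  p ^ℚ suc d ℚ.* ½ ^ℚ suc d      ≤⟨ *ℚ-mono-≤ (^ℚ-nonNeg (suc d) 0≤½) (^ℚ-nonNeg m (ℚ.≤-trans 0≤½ ½≤y)) p^≤y^ (^ℚ-mono (suc d) 0≤½ ½≤y) ⟩
  y ^ℚ m ℚ.* y ^ℚ suc d          ≡⟨ Exp.^-homo-* y m (suc d) ⟨
  y ^ℚ (m + suc d)               ∎
  where
  open ℚ.≤-Reasoning
  0≤½ = ℚ.nonNegative⁻¹ ½

½p^≤p^ : ∀ d → 0ℚ ℚ.< p → p ^ℚ suc d ℚ.≤ u → (½ ℚ.* p) ^ℚ suc d ℚ.≤ u
½p^≤p^ d 0<p p^≤u = ℚ.≤-trans (^ℚ-mono (suc d) (ℚ.<⇒≤ (½*-pos 0<p)) (ℚ.<⇒≤ (½*-< 0<p))) p^≤u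

-- The exponents `t` and `t + 1` enclose `s`; halving `p` makes it admissible for both.
^-◃ : ∀ (x : ℝ⁺) s t m d → ℚ.toℚᵘ t ℚᵘ.≃ mkℚᵘ (ℤ.+ m) d → t ◃ s → s ⊴ t ℚ.+ 1ℚ →
      0ℚ ℚ.< p → ½ ℚ.≤ y → y ◃ value x → p ^ℚ suc d ℚ.≤ y ^ℚ m → q ℚ.< ½ ℚ.* p → q ◃ value (x ^ s)
^-◃ {p} {y} x s t m d t≃ t◃s s⊴ 0<p ½≤y y◃x p^≤y^ q< =
  t , t ℚ.+ 1ℚ , t◃s , s⊴ ,
  powℚ-◃ x t m d t≃ (½*-pos 0<p) 0<y y◃x (½p^≤p^ d 0<p p^≤y^) q< ,
  powℚ-◃ x (t ℚ.+ 1ℚ) (m + suc d) d t+1≃ (½*-pos 0<p) 0<y y◃x (½p^≤y^ m d (ℚ.<⇒≤ 0<p) ½≤y p^≤y^) q<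
  where
  0<y = ℚ.<-≤-trans (ℚ.positive⁻¹ ½) ½≤y
  t+1≃ : ℚ.toℚᵘ (t ℚ.+ 1ℚ) ℚᵘ.≃ mkℚᵘ (ℤ.+ (m + suc d)) d
  t+1≃ = ℚᵘ.≃-trans (ℚ.toℚᵘ-homo-+ t 1ℚ) (ℚᵘ.≃-trans (ℚᵘ.+-congˡ (mkℚᵘ (ℤ.+ 1) 0) t≃)
    (*≡* (cong₂ ℤ._*_ (cong₂ ℤ._+_ (ℤ.*-identityʳ (ℤ.+ m)) (ℤ.*-identityˡ (ℤ.+ suc d)))
      (cong ℤ.+_ (sym (ℕ.*-identityʳ (suc d)))))))

-- Here the enclosing exponents are `s − 1` and `s`, read as positive powers of `x ⁻¹`, and it is
-- the lower one that costs the factor 2.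
^⁻-◃ : ∀ (x : ℝ⁺) m d → 0ℚ ℚ.< p → ½ ℚ.≤ y → y ◃ value (x ⁻¹) → p ^ℚ suc d ℚ.≤ y ^ℚ suc m →
       q ℚ.< ½ ℚ.* p → q ◃ value (x ^ fromℚ (- (ℤ.+ suc m ℚ./ suc d)))
^⁻-◃ {p} {y} x m d 0<p ½≤y y◃ p^≤y^ q< =
  s ℚ.- 1ℚ , s , subst (s ℚ.- 1ℚ ℚ.<_) (ℚ.+-identityʳ s) (ℚ.+-monoʳ-< s (ℚ.negative⁻¹ (- 1ℚ))) , ℚ.<⇒≤ ,
  powℚ-◃⁻ x (s ℚ.- 1ℚ) (m + suc d) d s-1≃ (½*-pos 0<p) 0<y y◃ (½p^≤y^ (suc m) d (ℚ.<⇒≤ 0<p) ½≤y p^≤y^) q< ,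
  powℚ-◃⁻ x s m d s≃ (½*-pos 0<p) 0<y y◃ (½p^≤p^ d 0<p p^≤y^) q<
  where
  0<y = ℚ.<-≤-trans (ℚ.positive⁻¹ ½) ½≤y
  s = - (ℤ.+ suc m ℚ./ suc d)
  s≃ : ℚ.toℚᵘ s ℚᵘ.≃ mkℚᵘ ℤ.-[1+ m ] d
  s≃ = ℚᵘ.≃-trans (ℚ.toℚᵘ-homo‿- (ℤ.+ suc m ℚ./ suc d)) (ℚᵘ.-‿cong (ℚ.toℚᵘ-fromℚᵘ (mkℚᵘ (ℤ.+ suc m) d)))
  s-1≃ : ℚ.toℚᵘ (s ℚ.- 1ℚ) ℚᵘ.≃ mkℚᵘ ℤ.-[1+ m + suc d ] d
  s-1≃ = ℚᵘ.≃-trans (ℚ.toℚᵘ-homo-+ s (- 1ℚ)) (ℚᵘ.≃-trans (ℚᵘ.+-congˡ (mkℚᵘ ℤ.-[1+ 0 ] 0) s≃)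
    (*≡* (cong₂ ℤ._*_ (trans (cong₂ ℤ._+_ (ℤ.*-identityʳ ℤ.-[1+ m ]) (ℤ.-1*i≡-i (ℤ.+ suc d)))
                             (cong ℤ.-[1+_] (sym (ℕ.+-suc m d))))
      (cong ℤ.+_ (sym (ℕ.*-identityʳ (suc d)))))))

module _ {ε : ℝ} (0<ε : 0ᴿ <ᴿ ε) where

  -- A positive element `(m + 1) / (d + 1)` of the cut is at least `1 / (d + 1)`, which is `2 / S`
  -- for `S = 2 (d + 1)`.
  2/[1+s]◃ : ∃ λ s → (ℤ.+ 1 ℚ./ suc s) ℚ.+ (ℤ.+ 1 ℚ./ suc s) ◃ ε
  2/[1+s]◃ with pos-element (ε ,⁺ 0<ε)
  ... | mkℚ (ℤ.+ zero) d c , 0<e , e◃ε = contradiction (ℚ.positive 0<e) λ ()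
  ... | mkℚ ℤ.-[1+ _ ] d c , 0<e , e◃ε = contradiction (ℚ.positive 0<e) λ ()
  ... | e@(mkℚ (ℤ.+ suc m) d c) , 0<e , e◃ε = d + suc d , downward ε η+η≤e e◃ε
    where
    S = suc d + suc d
    η = ℤ.+ 1 ℚ./ S
    S≤ : (S + 0 + (S + 0)) * suc d ≤ suc m * (S * S)
    S≤ = ℕ.≤-trans (ℕ.≤-reflexive (identity (suc d))) (ℕ.m≤n*m (S * S) (suc m))
      where
      identity : ∀ a → (a + a + 0 + (a + a + 0)) * a ≡ (a + a) * (a + a)
      identity = solve-∀
    η≃ = ℚ.toℚᵘ-fromℚᵘ (mkℚᵘ (ℤ.+ 1) (d + suc d))
    η+η≤e : η ℚ.+ η ℚ.≤ e
    η+η≤e = ℚ.toℚᵘ-cancel-≤ (ℚᵘ.≤-respˡ-≃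
      (ℚᵘ.≃-sym (ℚᵘ.≃-trans (ℚ.toℚᵘ-homo-+ η η) (ℚᵘ.+-cong η≃ η≃)))
      (ℚᵘ.*≤* (subst₂ ℤ._≤_ (ℤ.pos-* (S + 0 + (S + 0)) (suc d)) (ℤ.pos-* (suc m) (S * S)) (ℤ.+≤+ S≤))))

-- Since `κ` is not in its own open cut, `κ + η` is split as `(κ − η) + 2 η`; this is why `ε` has to
-- exceed two copies of `η`.
exponent-◃ : ∀ κ η ε → η ℚ.+ η ◃ ε → 0ℚ ℚ.< η → κ ℚ.+ η ◃ fromℚ κ +ᴿ ε
exponent-◃ κ η ε 2η◃ε 0<η = κ ℚ.- η , η ℚ.+ η ,
  subst (κ ℚ.- η ℚ.<_) (ℚ.+-identityʳ κ) (ℚ.+-monoʳ-< κ (ℚ.neg-antimono-< 0<η)) , 2η◃ε ,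
  ℚ.≤-reflexive (solve 2 (λ κ η → κ :+ η := (κ :+ :- η) :+ (η :+ η)) refl κ η)
  where open +-*-Solver

-- The assumption `ε < 1` confines the exponent to an interval of length one above `κ + η`, as `^-◃`
-- requires.
exponent-⊴ : ∀ κ η ε → ε <ᴿ 1ᴿ → 0ℚ ℚ.≤ η → fromℚ κ +ᴿ ε ⊴ κ ℚ.+ η ℚ.+ 1ℚ
exponent-⊴ κ η ε (c , ε⊴c , c<1) 0≤η (a , b , a<κ , b◃ε , q≤) = ℚ.≤-trans q≤
  (ℚ.+-mono-≤ (ℚ.≤-trans (ℚ.<⇒≤ a<κ) (subst (ℚ._≤ κ ℚ.+ η) (ℚ.+-identityʳ κ) (ℚ.+-monoʳ-≤ κ 0≤η)))
              (ℚ.≤-trans (ε⊴c b◃ε) (ℚ.<⇒≤ c<1)))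

-- If `a n > t`, take a larger `a′` in the cut and `b = a n / a′ < n`. Then `a′ b = a n > t` puts
-- `t` below the product, hence below itself.
*fromℕ-≤ : ∀ x n t {a} → 0 < n → x *ᴿ fromℕ n ≤ᴿ fromℕ t → 0ℚ ℚ.< a → a ◃ x → a ℚ.* ι n ℚ.≤ ι t
*fromℕ-≤ x n t {a} 0<n xn≤t 0<a a◃x with a ℚ.* ι n ℚ.≤? ι t
... | yes ≤t = ≤t
... | no  ≰t =
  let a′ , a<a′ , a′◃x = rounded x a◃x
      0<a′ = ℚ.<-trans 0<a a<a′
      i , 0<i , ia′≡1 = reciprocal 0<a′
      0<n′ = ι-pos n 0<n
      b = i ℚ.* a ℚ.* ι n
      b<n = subst (b ℚ.<_) (trans (cong (ℚ._* ι n) ia′≡1) (ℚ.*-identityˡ (ι n)))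
              (ℚ.*-monoˡ-<-pos (ι n) {{ℚ.positive 0<n′}} (ℚ.*-monoʳ-<-pos i {{ℚ.positive 0<i}} a<a′))
      a′b≡an = trans (solve 4 (λ a′ i a n → a′ :* (i :* a :* n) := (i :* a′) :* (a :* n)) refl a′ i a (ι n))
                 (trans (cong (ℚ._* (a ℚ.* ι n)) ia′≡1) (ℚ.*-identityˡ _))
  in contradiction (xn≤t (*-◃ x (fromℕ n) 0<a′ a′◃x (*-pos (*-pos 0<i 0<a) 0<n′) b<n
       (subst (ι t ℚ.<_) (sym a′b≡an) (ℚ.≰⇒> ≰t)))) (ℚ.<-irrefl refl)
  where open +-*-Solver

fromℤ-pos : ∀ {x i} → 1ᴿ ≤ᴿ x → x ≤ᴿ fromℤ i → ℤ.+ 0 ℤ.< i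
fromℤ-pos {x} {i} 1≤x x≤i with ℚᵘ.<-respʳ-≃ (ℚ.toℚᵘ-fromℚᵘ (mkℚᵘ i 0)) (ℚ.toℚᵘ-mono-< (x≤i (1≤x 0<1)))
... | ℚᵘ.*<* lt = subst (ℤ.+ 0 ℤ.<_) (ℤ.*-identityʳ i) lt

-- Extraction of the root

constant : (k₁ s K : ℕ) → ℕ
constant k₁ s K = let k = suc (suc k₁) in
  -- The factors come, in order, from the integer root `v`, the divisor bound, and the halvings of
  -- `r` and `ℓ` in `take-root`.
  2 ^ℕ (suc k₁ * suc s) * K * 2 ^ℕ (k * suc s) * 2 ^ℕ (k * suc s + suc k₁)

constant-pos : ∀ k₁ s {K} → 0 < K → 0 < constant k₁ s K
constant-pos k₁ s 0<K = let k = suc (suc k₁) in ℕ.*-mono-< (ℕ.*-mono-< (ℕ.*-mono-<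
  (ℕ.m^n>0 2 (suc k₁ * suc s)) 0<K) (ℕ.m^n>0 2 (k * suc s))) (ℕ.m^n>0 2 (k * suc s + suc k₁))

-- Here `P` and `Q` majorise `(½ r)^(k / (k − 1))` and `(½ ℓ)^(m / N)`, and `v` is at most twice the
-- `(k − 1)`-th root of `W`. Comparing `N`-th powers reduces the claim to the integer inequality;
-- `m / N` equals `k / (k − 1) + 1 / (S + 1)`.
take-root : ∀ k₁ S {n t W ℓ K v : ℕ} {r P Q : ℚ} → let k = suc (suc k₁) ; m = k * suc S + suc k₁ ; N = suc k₁ * suc S in
  0 < n → 1 ≤ ℓ → 0 < K → 0ℚ ℚ.< r → 0ℚ ℚ.< P → 0ℚ ℚ.< Q → r ℚ.* ι t ≡ ι n →
  t ^ℕ (k * suc S) * W ^ℕ suc S ≤ n ^ℕ suc S * (K * ℓ ^ℕ suc (k * suc S)) →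
  (½ ℚ.* r) ^ℚ k ℚ.≤ P ^ℚ suc k₁ → (½ ℚ.* ι ℓ) ^ℚ m ℚ.≤ Q ^ℚ N → v ^ℕ suc k₁ ≤ 2 ^ℕ suc k₁ * W →
  ι n ℚ.* ι v ℚ.≤ ι (constant k₁ S K) ℚ.* (P ℚ.* Q)
take-root k₁ S′ {n} {t} {W} {ℓ} {K} {v} {r} {P} {Q} 0<n 1≤ℓ 0<K 0<r 0<P 0<Q rt≡n core r≤P ℓ≤Q v≤W =
  ^ℚ-cancel-≤ (S′ + k₁ * S) (ℚ.<⇒≤ (*-pos (ι-pos c 0<c) (*-pos 0<P 0<Q))) (begin
    (ι n ℚ.* ι v) ^ℚ N                           ≡⟨ Exp.^-distrib-* (ι n) (ι v) N ⟩
    ι n ^ℚ N ℚ.* ι v ^ℚ N                        ≡⟨ cong₂ ℚ._*_ (sym (ι-^ n N)) (sym (ι-^ v N)) ⟩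
    ι (n ^ℕ N) ℚ.* ι (v ^ℕ N)                    ≤⟨ ℚ.*-monoˡ-≤-nonNeg (ι (n ^ℕ N)) {{ι-nonNeg (n ^ℕ N)}} (ι-mono v^N≤) ⟩
    ι (n ^ℕ N) ℚ.* ι (2 ^ℕ N * W ^ℕ S)           ≡⟨ cong (ι (n ^ℕ N) ℚ.*_) (ι-* (2 ^ℕ N) (W ^ℕ S)) ⟩
    ι (n ^ℕ N) ℚ.* (ι (2 ^ℕ N) ℚ.* ι (W ^ℕ S))   ≡⟨ swap (ι (n ^ℕ N)) (ι (2 ^ℕ N)) (ι (W ^ℕ S)) ⟩
    ι (2 ^ℕ N) ℚ.* (ι (n ^ℕ N) ℚ.* ι (W ^ℕ S))   ≤⟨ ℚ.*-monoˡ-≤-nonNeg (ι (2 ^ℕ N)) {{ι-nonNeg (2 ^ℕ N)}} n^W^≤ ⟩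
    ι (2 ^ℕ N) ℚ.* (ι K ℚ.* (r ^ℚ (k * S) ℚ.* ι ℓ ^ℚ m))
      ≤⟨ ℚ.*-monoˡ-≤-nonNeg (ι (2 ^ℕ N)) {{ι-nonNeg (2 ^ℕ N)}} (ℚ.*-monoˡ-≤-nonNeg (ι K) {{ι-nonNeg K}}
          (*ℚ-mono-≤ (^ℚ-nonNeg m 0≤ℓ) (ℚ.<⇒≤ (*-pos (ι-pos (2 ^ℕ (k * S)) (ℕ.m^n>0 2 (k * S))) (^ℚ-pos N 0<P))) r^≤ ℓ^≤)) ⟩
    ι (2 ^ℕ N) ℚ.* (ι K ℚ.* (ι (2 ^ℕ (k * S)) ℚ.* P ^ℚ N ℚ.* (ι (2 ^ℕ m) ℚ.* Q ^ℚ N)))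
      ≡⟨ regroup (ι (2 ^ℕ N)) (ι K) (ι (2 ^ℕ (k * S))) (P ^ℚ N) (ι (2 ^ℕ m)) (Q ^ℚ N) ⟩
    ι (2 ^ℕ N) ℚ.* ι K ℚ.* ι (2 ^ℕ (k * S)) ℚ.* ι (2 ^ℕ m) ℚ.* (P ^ℚ N ℚ.* Q ^ℚ N)
      ≡⟨ cong₂ ℚ._*_ ι-c (Exp.^-distrib-* P Q N) ⟨
    ι c ℚ.* (P ℚ.* Q) ^ℚ N
      ≤⟨ ℚ.*-monoʳ-≤-nonNeg ((P ℚ.* Q) ^ℚ N) {{ℚ.nonNegative (^ℚ-nonNeg N (ℚ.<⇒≤ (*-pos 0<P 0<Q)))}} c≤c^ ⟩
    ι c ^ℚ N ℚ.* (P ℚ.* Q) ^ℚ N                  ≡⟨ Exp.^-distrib-* (ι c) (P ℚ.* Q) N ⟨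
    (ι c ℚ.* (P ℚ.* Q)) ^ℚ N                     ∎)
  where
  open ℚ.≤-Reasoning
  open +-*-Solver
  S = suc S′
  k = suc (suc k₁)
  m = k * S + suc k₁
  N = suc k₁ * S
  c = constant k₁ S′ K

  ι-nonNeg : ∀ n → ℚ.NonNegative (ι n)
  ι-nonNeg n = ℚ.nonNegative (ι-mono (z≤n {n}))

  0<c : 0 < c
  0<c = constant-pos k₁ S′ 0<K

  0≤ℓ : 0ℚ ℚ.≤ ι ℓ
  0≤ℓ = ι-mono (z≤n {ℓ})

  ι-c : ι c ≡ ι (2 ^ℕ N) ℚ.* ι K ℚ.* ι (2 ^ℕ (k * S)) ℚ.* ι (2 ^ℕ m)
  ι-c = trans (ι-* (2 ^ℕ N * K * 2 ^ℕ (k * S)) (2 ^ℕ m)) (cong (ℚ._* ι (2 ^ℕ m)) (trans (ι-* (2 ^ℕ N * K) (2 ^ℕ (k * S))) (cong (ℚ._* ι (2 ^ℕ (k * S))) (ι-* (2 ^ℕ N) K))))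

  c≤c^ : ι c ℚ.≤ ι c ^ℚ N
  -- As `c ≥ 1`, the constant need not be rooted: it is weakened to its own `N`-th power.
  c≤c^ = subst (ℚ._≤ ι c ^ℚ N) (ℚ.*-identityʳ (ι c)) (^ℚ-monoʳ {m = 1} {n = N} (ι-mono 0<c) (s≤s z≤n))

  swap : ∀ a b c → a ℚ.* (b ℚ.* c) ≡ b ℚ.* (a ℚ.* c)
  swap = solve 3 (λ a b c → a :* (b :* c) := b :* (a :* c)) refl

  regroup : ∀ a b c d e f → a ℚ.* (b ℚ.* (c ℚ.* d ℚ.* (e ℚ.* f))) ≡ a ℚ.* b ℚ.* c ℚ.* e ℚ.* (d ℚ.* f)
  regroup = solve 6 (λ a b c d e f → a :* (b :* (c :* d :* (e :* f))) := a :* b :* c :* e :* (d :* f)) refl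

  v^N≤ : v ^ℕ N ≤ 2 ^ℕ N * W ^ℕ S
  v^N≤ = subst₂ _≤_ (ℕ.^-*-assoc v (suc k₁) S)
    (trans (^-distrib-* (2 ^ℕ suc k₁) W S) (cong (_* W ^ℕ S) (ℕ.^-*-assoc 2 (suc k₁) S))) (ℕ.^-monoˡ-≤ S v≤W)

  n^W^≤ : ι (n ^ℕ N) ℚ.* ι (W ^ℕ S) ℚ.≤ ι K ℚ.* (r ^ℚ (k * S) ℚ.* ι ℓ ^ℚ m)
  -- Since `k S = S + N`, the `n ^ S` on the right side of `core` cancels and leaves `n ^ N` on the
  -- left.
  n^W^≤ = ℚ.*-cancelˡ-≤-pos (ι (n ^ℕ S)) {{ℚ.positive (ι-pos (n ^ℕ S) (ℕ.m^n>0 n {{ℕ.>-nonZero 0<n}} S))}} (begin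
    ι (n ^ℕ S) ℚ.* (ι (n ^ℕ N) ℚ.* ι (W ^ℕ S))
      ≡⟨ trans (sym (ℚ.*-assoc (ι (n ^ℕ S)) _ _)) (cong (ℚ._* ι (W ^ℕ S)) (trans (sym (ι-* (n ^ℕ S) (n ^ℕ N))) (cong ι (sym (ℕ.^-distribˡ-+-* n S N))))) ⟩
    ι (n ^ℕ (k * S)) ℚ.* ι (W ^ℕ S)
      ≡⟨ cong (ℚ._* ι (W ^ℕ S)) (trans (ι-^ n (k * S)) (trans (cong (_^ℚ (k * S)) (sym rt≡n)) (trans (Exp.^-distrib-* r (ι t) (k * S)) (cong (r ^ℚ (k * S) ℚ.*_) (sym (ι-^ t (k * S))))))) ⟩
    r ^ℚ (k * S) ℚ.* ι (t ^ℕ (k * S)) ℚ.* ι (W ^ℕ S)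
      ≡⟨ trans (ℚ.*-assoc (r ^ℚ (k * S)) _ _) (cong (r ^ℚ (k * S) ℚ.*_) (sym (ι-* (t ^ℕ (k * S)) (W ^ℕ S)))) ⟩
    r ^ℚ (k * S) ℚ.* ι (t ^ℕ (k * S) * W ^ℕ S)
      ≤⟨ ℚ.*-monoˡ-≤-nonNeg (r ^ℚ (k * S)) {{ℚ.nonNegative (^ℚ-nonNeg (k * S) (ℚ.<⇒≤ 0<r))}} (ι-mono (ℕ.≤-trans core ℓ^suc≤)) ⟩
    r ^ℚ (k * S) ℚ.* ι (n ^ℕ S * (K * ℓ ^ℕ m))
      ≡⟨ cong (r ^ℚ (k * S) ℚ.*_) (trans (ι-* (n ^ℕ S) (K * ℓ ^ℕ m)) (cong (ι (n ^ℕ S) ℚ.*_) (trans (ι-* K (ℓ ^ℕ m)) (cong (ι K ℚ.*_) (ι-^ ℓ m))))) ⟩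
    r ^ℚ (k * S) ℚ.* (ι (n ^ℕ S) ℚ.* (ι K ℚ.* ι ℓ ^ℚ m))
      ≡⟨ solve 4 (λ a b c d → a :* (b :* (c :* d)) := b :* (c :* (a :* d))) refl (r ^ℚ (k * S)) (ι (n ^ℕ S)) (ι K) (ι ℓ ^ℚ m) ⟩
    ι (n ^ℕ S) ℚ.* (ι K ℚ.* (r ^ℚ (k * S) ℚ.* ι ℓ ^ℚ m)) ∎)
    where
    ℓ^suc≤ : n ^ℕ S * (K * ℓ ^ℕ suc (k * S)) ≤ n ^ℕ S * (K * ℓ ^ℕ m)
    ℓ^suc≤ = ℕ.*-monoʳ-≤ (n ^ℕ S) (ℕ.*-monoʳ-≤ K (ℕ.^-monoʳ-≤ ℓ {{ℕ.>-nonZero 1≤ℓ}}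
      (ℕ.≤-trans (ℕ.≤-reflexive (ℕ.+-comm 1 (k * S))) (ℕ.+-monoʳ-≤ (k * S) (s≤s (z≤n {k₁}))))))

  r^≤ : r ^ℚ (k * S) ℚ.≤ ι (2 ^ℕ (k * S)) ℚ.* P ^ℚ N
  r^≤ = subst₂ ℚ._≤_ (sym (^-halve r (k * S))) (cong (ℚ._* P ^ℚ N) (sym (ι-^ 2 (k * S))))
    (ℚ.*-monoˡ-≤-nonNeg (ι 2 ^ℚ (k * S)) {{ℚ.nonNegative (^ℚ-nonNeg (k * S) (ι-mono (z≤n {2})))}}
      (subst₂ ℚ._≤_ (Exp.^-assocʳ (½ ℚ.* r) k S) (Exp.^-assocʳ P (suc k₁) S)
        (^ℚ-mono S (^ℚ-nonNeg k (ℚ.<⇒≤ (½*-pos 0<r))) r≤P)))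

  ℓ^≤ : ι ℓ ^ℚ m ℚ.≤ ι (2 ^ℕ m) ℚ.* Q ^ℚ N
  ℓ^≤ = subst₂ ℚ._≤_ (sym (^-halve (ι ℓ) m)) (cong (ℚ._* Q ^ℚ N) (sym (ι-^ 2 m)))
    (ℚ.*-monoˡ-≤-nonNeg (ι 2 ^ℚ m) {{ℚ.nonNegative (^ℚ-nonNeg m (ι-mono (z≤n {2})))}} ℓ≤Q)

-- Integer data from the real hypotheses

record Reduction {k} (X : Fin k → ℝ⁺) (L δ : ℝ⁺) (n S K : ℕ) : Set where
  field
    x    : Fin k → ℕ
    ℓ t  : ℕ
    0<x  : ∀ i → 0 < x i
    X⊴x  : ∀ i → value (X i) ⊴ ι (x i)
    0<ℓ  : 0 < ℓ
    ℓ≤L  : fromℕ ℓ ≤ᴿ value L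
    0<t  : 0 < t
    t≤n  : t ≤ n
    δn≤t : ∀ {a} → 0ℚ ℚ.< a → a ◃ value δ → a ℚ.* ι n ℚ.≤ ι t
    core : t ^ℕ (k * S) * ∏ℕ x ^ℕ S ≤ n ^ℕ S * (K * ℓ ^ℕ suc (k * S))

reduction : ∀ {k} S K → 0 < k →
  (∀ ℓ → ∃ λ D → D ^ℕ (k * k * S) ≤ K * ℓ × ∀ n → ∃ λ ds → (0 < n → n ≤ ℓ → Covers ds n) × length ds ≤ D) →
  (X : Fin k → ℝ⁺) (L δ : ℝ⁺) → (∀ i → 1ᴿ ≤ᴿ value (X i)) → value δ ≤ᴿ 1ᴿ →
  (A : Fin k → FiniteSet ℤ) → (∀ i {a} → a ∈ A i → value (X i) ≤ᴿ fromℤ a) →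
  (T : FiniteSet (Vec ℤ k)) → (∀ {a} → a ∈ T → (∀ i → lookup a i ∈ A i) × fromℤ (lcms a) ≤ᴿ value L) →
  value δ *ᴿ fromℕ (∏ℕ λ i → ∣ A i ∣) ≤ᴿ fromℕ ∣ T ∣ →
  0 < (∏ℕ λ i → ∣ A i ∣) → Reduction X L δ (∏ℕ λ i → ∣ A i ∣) S K
reduction {k@(suc _)} S K _ divisor-bound X L δ 1≤X δ≤1 A X≤A T T-ok δn≤T 0<n = record
  { x    = x
  ; ℓ    = ℓ
  -- The cap at `n` ensures `n / t ≥ 1`, and it preserves `δ n ≤ t` because `δ ≤ 1`.
  ; t    = ∣ T ∣ ℕ.⊓ n
  ; 0<x  = λ i → pos⇒0<∣∣ (A-pos i (proj₁ (proj₂ (least i))))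
  ; X⊴x  = λ i {q} q◃X → ℚ.<⇒≤ (subst (λ a → q ℚ.< a ℚ./ 1)
             (sym (ℤ.0≤i⇒+∣i∣≡i (ℤ.<⇒≤ (A-pos i (proj₁ (proj₂ (least i)))))))
             (X≤A i (proj₁ (proj₂ (least i))) q◃X))
  ; 0<ℓ  = lcms>0 τ (λ i → pos⇒0<∣∣ (T-pos τ∈T i))
  ; ℓ≤L  = λ {q} q<ℓ → proj₂ (T-ok τ∈T) (subst (λ a → q ℚ.< a ℚ./ 1) (sym (lcms-+ τ)) q<ℓ)
  ; 0<t  = ℕ.⊓-glb 0<∣T∣ 0<n
  ; t≤n  = ℕ.m⊓n≤n ∣ T ∣ n
  ; δn≤t = δn≤t
  ; core = powers-bound x (λ i → ∣ A i ∣) {ℓ = ℓ} {D} {K} S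
             (λ i → tuples-bound (elements T) (unique T) ℓ D cover (λ v∈ → T-pos v∈ , ℓ-max v∈) i (elements (A i)) (x i)
                      (λ v∈ → proj₁ (T-ok v∈) i) (pos⇒0<∣∣ (A-pos i (proj₁ (proj₂ (least i))))) (proj₂ (proj₂ (least i))))
             (ℕ.m⊓n≤m ∣ T ∣ n) (proj₁ (proj₂ (divisor-bound ℓ)))
  }
  where
  n = ∏ℕ λ i → ∣ A i ∣

  A-pos : ∀ i {a} → a ∈ A i → ℤ.+ 0 ℤ.< a
  A-pos i a∈ = fromℤ-pos {value (X i)} (λ {q} → 1≤X i {q}) (λ {q} → X≤A i a∈ {q})

  pos⇒0<∣∣ : ∀ {a} → ℤ.+ 0 ℤ.< a → 0 < ℤ.∣ a ∣
  pos⇒0<∣∣ (ℤ.+<+ 0<a) = 0<a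

  T-pos : ∀ {v} → v ∈ T → ∀ i → ℤ.+ 0 ℤ.< lookup v i
  T-pos v∈ i = A-pos i (proj₁ (T-ok v∈) i)

  least : ∀ i → ∃ λ a → a ∈ A i × ∀ {b} → b ∈ A i → ℤ.∣ a ∣ ≤ ℤ.∣ b ∣
  least i = minimum ℤ.∣_∣ (elements (A i)) (∏ℕ-pos⁻¹ (λ i → ∣ A i ∣) 0<n i)

  x : Fin k → ℕ
  x i = ℤ.∣ proj₁ (least i) ∣

  δn≤T′ : ∀ {a} → 0ℚ ℚ.< a → a ◃ value δ → a ℚ.* ι n ℚ.≤ ι ∣ T ∣
  δn≤T′ = *fromℕ-≤ (value δ) n ∣ T ∣ 0<n (λ {q} → δn≤T {q})

  δn≤t : ∀ {a} → 0ℚ ℚ.< a → a ◃ value δ → a ℚ.* ι n ℚ.≤ ι (∣ T ∣ ℕ.⊓ n)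
  δn≤t {a} 0<a a◃δ with ℕ.⊓-sel ∣ T ∣ n
  ... | inj₁ eq = subst (λ t → a ℚ.* ι n ℚ.≤ ι t) (sym eq) (δn≤T′ 0<a a◃δ)
  ... | inj₂ eq = subst (λ t → a ℚ.* ι n ℚ.≤ ι t) (sym eq) (subst (a ℚ.* ι n ℚ.≤_) (ℚ.*-identityˡ (ι n))
    (ℚ.*-monoʳ-≤-nonNeg (ι n) {{ℚ.nonNegative (ℚ.<⇒≤ (ι-pos n 0<n))}} (ℚ.<⇒≤ (δ≤1 a◃δ))))

  0<∣T∣ : 0 < ∣ T ∣
  0<∣T∣ = ℕ.n≢0⇒n>0 λ ∣T∣≡0 → let a , 0<a , a◃δ = pos-element δ in
    contradiction (*-pos 0<a (ι-pos n 0<n)) (≤ℚ⇒≯ (subst (λ t → a ℚ.* ι n ℚ.≤ ι t) ∣T∣≡0 (δn≤T′ 0<a a◃δ)))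

  greatest = maximum (ℤ.∣_∣ ∘ lcms) (elements T) 0<∣T∣
  τ = proj₁ greatest
  τ∈T = proj₁ (proj₂ greatest)
  ℓ = ℤ.∣ lcms τ ∣
  ℓ-max : ∀ {w} → w ∈ T → ℤ.∣ lcms w ∣ ≤ ℓ
  ℓ-max = proj₂ (proj₂ greatest)

  D = proj₁ (divisor-bound ℓ)
  cover = proj₂ (proj₂ (divisor-bound ℓ))

-- Return to the real inequality

≤0⇒≤⁺ : ∀ (x : ℝ⁺) n → n ≤ 0 → fromℕ n ≤ᴿ value x
≤0⇒≤⁺ x n n≤0 q<n = let a , 0<a , a◃x = pos-element x in
  downward (value x) (ℚ.<⇒≤ (ℚ.<-trans (ℚ.<-≤-trans q<n (ι-mono n≤0)) 0<a)) a◃x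

module _ (k₁ s K : ℕ) (ε : ℝ) (ε<1 : ε <ᴿ 1ᴿ) (2η◃ε : (ℤ.+ 1 ℚ./ suc s) ℚ.+ (ℤ.+ 1 ℚ./ suc s) ◃ ε) (0<K : 0 < K) where

  private
    k S m N c₁ : ℕ
    k = suc (suc k₁)
    S = suc s
    m = k * S + suc k₁
    N = suc k₁ * S
    c₁ = constant k₁ s K

    κ η : ℚ
    κ = k /[ k -1]
    η = ℤ.+ 1 ℚ./ S

    -- 1024 = 2¹⁰ absorbs the halvings that make the rational bounds strict.
    c : ℚ
    c = ι 1024 ℚ.* ι c₁

    0<c : 0ℚ ℚ.< c
    0<c = *-pos (ι-pos 1024 (s≤s z≤n)) (ι-pos c₁ (constant-pos k₁ s 0<K))

    κ+η≃ : ℚ.toℚᵘ (κ ℚ.+ η) ℚᵘ.≃ mkℚᵘ (ℤ.+ m) (s + k₁ * S)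
    κ+η≃ = ℚᵘ.≃-trans (ℚ.toℚᵘ-homo-+ κ η) (ℚᵘ.≃-trans
      (ℚᵘ.+-cong (ℚ.toℚᵘ-fromℚᵘ (mkℚᵘ (ℤ.+ k) k₁)) (ℚ.toℚᵘ-fromℚᵘ (mkℚᵘ (ℤ.+ 1) s)))
      (ℚᵘ.≃-reflexive (cong (λ i → mkℚᵘ i (s + k₁ * S))
        (cong₂ ℤ._+_ (sym (ℤ.pos-* k S)) (ℤ.*-identityˡ (ℤ.+ suc k₁))))))

  C : ℝ⁺
  C = fromℚ c ,⁺ (0ℚ , ℚ.<⇒≤ , 0<c)

  reduction⇒bound : (X : Fin k → ℝ⁺) (L δ : ℝ⁺) (n : ℕ) → (∀ i → 1ᴿ ≤ᴿ value (X i)) → 0 < n →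
    Reduction X L δ n S K →
    fromℕ n ≤ᴿ value (C *⁺ δ ^ fromℚ (- κ) *⁺ (L ^ (fromℚ κ +ᴿ ε) /⁺ ∏⁺ X ^ fromℚ (1 /[ k -1])))
  reduction⇒bound X L δ n 1≤X 0<n red {q} q<n =
    *-◃ {q} (value (C *⁺ δ ^ fromℚ (- κ))) (value (L ^ (fromℚ κ +ᴿ ε) /⁺ ∏⁺ X ^ fromℚ (1 /[ k -1])))
      (½*-pos 0<ca)
      (*-◃ (value C) (value (δ ^ fromℚ (- κ))) (½*-pos 0<c) (½*-< 0<c) (½*-pos (½*-pos 0<P)) a◃ (½*-< 0<ca))
      (½*-pos 0<bw)
      (*-◃ (value (L ^ (fromℚ κ +ᴿ ε))) (value ((∏⁺ X ^ fromℚ (1 /[ k -1])) ⁻¹))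
        (½*-pos (½*-pos 0<Q)) b◃ (½*-pos 0<w) w◃ (½*-< 0<bw))
      (ℚ.<-≤-trans q<n n≤)
    where
    open Reduction red
    open +-*-Solver

    recip-t = reciprocal (ι-pos t 0<t)
    recip-n = reciprocal (ι-pos n 0<n)
    1/t = proj₁ recip-t
    1/n = proj₁ recip-n
    -- `R = n / t` bounds `1 / δ` from below, through the upper bound `U = t / n` for `δ`. From
    -- `R ≥ 1` the base `½ R` is at least `½`, as the power estimate requires.
    R = ι n ℚ.* 1/t
    0<R : 0ℚ ℚ.< R
    0<R = *-pos (ι-pos n 0<n) (proj₁ (proj₂ recip-t))
    Rt≡n : R ℚ.* ι t ≡ ι n
    Rt≡n = trans (ℚ.*-assoc (ι n) 1/t (ι t)) (trans (cong (ι n ℚ.*_) (proj₂ (proj₂ recip-t))) (ℚ.*-identityʳ (ι n)))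
    1≤R : 1ℚ ℚ.≤ R
    1≤R = subst₂ ℚ._≤_ (trans (ℚ.*-comm (ι t) 1/t) (proj₂ (proj₂ recip-t))) refl
      (ℚ.*-monoʳ-≤-nonNeg 1/t {{ℚ.nonNegative (ℚ.<⇒≤ (proj₁ (proj₂ recip-t)))}} (ι-mono t≤n))

    U = ι t ℚ.* 1/n
    0<U : 0ℚ ℚ.< U
    0<U = *-pos (ι-pos t 0<t) (proj₁ (proj₂ recip-n))
    δ⊴U : value δ ⊴ U
    δ⊴U {a} a◃δ with ℚ.≤-total a 0ℚ
    ... | inj₁ a≤0 = ℚ.≤-trans a≤0 (ℚ.<⇒≤ 0<U)
    ... | inj₂ 0≤a with 0ℚ ℚ.<? a
    ...   | no  a≯0 = ℚ.≤-trans (ℚ.≮⇒≥ a≯0) (ℚ.<⇒≤ 0<U)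
    ...   | yes 0<a = ℚ.*-cancelʳ-≤-pos (ι n) {{ℚ.positive (ι-pos n 0<n)}}
            (subst (a ℚ.* ι n ℚ.≤_) (sym Un≡t) (δn≤t 0<a a◃δ))
      where
      Un≡t : U ℚ.* ι n ≡ ι t
      Un≡t = trans (ℚ.*-assoc (ι t) 1/n (ι n)) (trans (cong (ι t ℚ.*_) (proj₂ (proj₂ recip-n))) (ℚ.*-identityʳ (ι t)))
    RU≡1 : R ℚ.* U ≡ 1ℚ
    RU≡1 = trans (solve 4 (λ n i t j → (n :* i) :* (t :* j) := (j :* n) :* (i :* t)) refl (ι n) 1/t (ι t) 1/n)
      (cong₂ ℚ._*_ (proj₂ (proj₂ recip-n)) (proj₂ (proj₂ recip-t)))

    ½≤½* : ∀ {p} → 1ℚ ℚ.≤ p → ½ ℚ.≤ ½ ℚ.* p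
    ½≤½* = ℚ.*-monoˡ-≤-nonNeg ½

    rootP = rational-root k₁ (^ℚ-pos k (½*-pos 0<R))
    P = proj₁ rootP
    0<P = proj₁ (proj₂ rootP)
    a◃ : ½ ℚ.* (½ ℚ.* P) ◃ value (δ ^ fromℚ (- κ))
    a◃ = ^⁻-◃ δ (suc k₁) k₁ 0<P (½≤½* 1≤R)
      (⁻¹-◃ δ δ⊴U (ℚ.<⇒≤ 0<R) (ℚ.≤-reflexive RU≡1) (½*-< 0<R))
      (proj₁ (proj₂ (proj₂ rootP))) (½*-< (½*-pos 0<P))

    0<ℓ′ = ι-pos ℓ 0<ℓ
    -- The degree is `s + k₁ * S + 1 = N`, so `Q` approximates `½ ℓ` to the exponent
    -- `m / N = κ + η`.
    rootQ = rational-root (s + k₁ * S) (^ℚ-pos m (½*-pos 0<ℓ′))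
    Q = proj₁ rootQ
    0<Q = proj₁ (proj₂ rootQ)
    0<η : 0ℚ ℚ.< η
    0<η = ℚ.positive⁻¹ η {{ℚ.normalize-pos 1 S}}
    b◃ : ½ ℚ.* (½ ℚ.* Q) ◃ value (L ^ (fromℚ κ +ᴿ ε))
    b◃ = ^-◃ L (fromℚ κ +ᴿ ε) (κ ℚ.+ η) m (s + k₁ * S) κ+η≃ (exponent-◃ κ η ε 2η◃ε 0<η)
      (exponent-⊴ κ η ε ε<1 (ℚ.<⇒≤ 0<η)) 0<Q (½≤½* (ι-mono 0<ℓ)) (ℓ≤L (½*-< 0<ℓ′))
      (proj₁ (proj₂ (proj₂ rootQ))) (½*-< (½*-pos 0<Q))

    W = ∏ℕ x
    rootW = root k₁ W
    -- The root is rounded up because it bounds a denominator from above; as `W ≥ 1`, this at most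
    -- doubles it.
    V = suc (proj₁ rootW)
    V^≤ : V ^ℕ suc k₁ ≤ 2 ^ℕ suc k₁ * W
    V^≤ with proj₁ rootW | proj₂ rootW
    ... | zero  | _ , W< = contradiction (subst (W <_) (ℕ.^-zeroˡ (suc k₁)) W<) (ℕ.≤⇒≯ (∏ℕ-pos x 0<x))
    ... | ρ@(suc _) | ρ^≤ , _ = ℕ.≤-trans (ℕ.^-monoˡ-≤ (suc k₁) (ℕ.≤-trans (ℕ.+-monoˡ-≤ ρ (s≤s z≤n))
            (ℕ.≤-reflexive (cong (ρ +_) (sym (ℕ.+-identityʳ ρ))))))
          (ℕ.≤-trans (ℕ.≤-reflexive (^-distrib-* 2 ρ (suc k₁))) (ℕ.*-monoʳ-≤ (2 ^ℕ suc k₁) ρ^≤))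
    0<V = ι-pos V (s≤s z≤n)
    recip-v = reciprocal 0<V
    w = proj₁ recip-v
    0<w = proj₁ (proj₂ recip-v)
    w◃ : ½ ℚ.* w ◃ value ((∏⁺ X ^ fromℚ (1 /[ k -1])) ⁻¹)
    w◃ = ⁻¹-◃ (∏⁺ X ^ fromℚ (1 /[ k -1]))
      (λ {q} → ^-⊴ (∏⁺ X) k₁ (λ {q} → 1≤∏⁺ X (λ i {q} → 1≤X i {q}) {q}) (∏⁺-⊴ X x X⊴x) (ι-mono (s≤s (z≤n {proj₁ rootW})))
        (subst (ι W ℚ.≤_) (ι-^ V (suc k₁)) (ι-mono (ℕ.<⇒≤ (proj₂ (proj₂ rootW))))) {q})
      (ℚ.<⇒≤ 0<w) (ℚ.≤-reflexive (proj₂ (proj₂ recip-v))) (½*-< 0<w)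

    0<ca = *-pos (½*-pos 0<c) (½*-pos (½*-pos 0<P))
    0<bw = *-pos (½*-pos (½*-pos 0<Q)) (½*-pos 0<w)

    -- `rational-root` bounds its argument by powers of `2 P` and `2 Q` only. These two doublings
    -- and the eight halvings in `n≤` use up the factor 1024.
    2P = ι 2 ℚ.* P
    2Q = ι 2 ℚ.* Q
    n*V≤ : ι n ℚ.* ι V ℚ.≤ ι c₁ ℚ.* (2P ℚ.* 2Q)
    n*V≤ = take-root k₁ s {n} {t} {W} {ℓ} {K} {V} {R} 0<n 0<ℓ 0<K 0<R
      (*-pos (ι-pos 2 (s≤s z≤n)) 0<P) (*-pos (ι-pos 2 (s≤s z≤n)) 0<Q) Rt≡n core
      (proj₂ (proj₂ (proj₂ rootP))) (proj₂ (proj₂ (proj₂ rootQ))) V^≤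

    n≤ : ι n ℚ.≤ ½ ℚ.* (½ ℚ.* c ℚ.* (½ ℚ.* (½ ℚ.* P))) ℚ.* (½ ℚ.* (½ ℚ.* (½ ℚ.* Q) ℚ.* (½ ℚ.* w)))
    n≤ = begin
      ι n                                       ≡⟨ ℚ.*-identityʳ (ι n) ⟨
      ι n ℚ.* 1ℚ                                ≡⟨ cong (ι n ℚ.*_) (trans (ℚ.*-comm (ι V) w) (proj₂ (proj₂ recip-v))) ⟨
      ι n ℚ.* (ι V ℚ.* w)                       ≡⟨ ℚ.*-assoc (ι n) (ι V) w ⟨
      ι n ℚ.* ι V ℚ.* w                         ≤⟨ ℚ.*-monoʳ-≤-nonNeg w {{ℚ.nonNegative (ℚ.<⇒≤ 0<w)}} n*V≤ ⟩
      ι c₁ ℚ.* (2P ℚ.* 2Q) ℚ.* w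
        ≡⟨ solve 4 (λ c P Q w → c :* ((con (ι 2) :* P) :* (con (ι 2) :* Q)) :* w :=
             con ½ :* (con ½ :* (con (ι 1024) :* c) :* (con ½ :* (con ½ :* P))) :* (con ½ :* (con ½ :* (con ½ :* Q) :* (con ½ :* w))))
             refl (ι c₁) P Q w ⟩
      ½ ℚ.* (½ ℚ.* c ℚ.* (½ ℚ.* (½ ℚ.* P))) ℚ.* (½ ℚ.* (½ ℚ.* (½ ℚ.* Q) ℚ.* (½ ℚ.* w))) ∎
      where open ℚ.≤-Reasoning

  product-bound : (∀ ℓ → ∃ λ D → D ^ℕ (k * k * S) ≤ K * ℓ × ∀ n → ∃ λ ds → (0 < n → n ≤ ℓ → Covers ds n) × length ds ≤ D) →
    (X : Fin k → ℝ⁺) (L δ : ℝ⁺) → (∀ i → 1ᴿ ≤ᴿ value (X i)) → 1ᴿ ≤ᴿ value L → (∀ i → value (X i) ≤ᴿ value L) →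
    value δ ≤ᴿ 1ᴿ →
    (A : Fin k → FiniteSet ℤ) →
    (∀ i {a} → a ∈ A i → value (X i) ≤ᴿ fromℤ a × fromℤ a ≤ᴿ 2ᴿ *ᴿ value (X i)) →
    (∃ λ (T : FiniteSet (Vec ℤ k)) →
       (∀ {a} → a ∈ T → (∀ i → lookup a i ∈ A i) × fromℤ (lcms a) ≤ᴿ value L) ×
       value δ *ᴿ fromℕ (∏ℕ λ i → ∣ A i ∣) ≤ᴿ fromℕ ∣ T ∣) →
    fromℕ (∏ℕ λ i → ∣ A i ∣)
      ≤ᴿ value (C *⁺ δ ^ fromℚ (- κ) *⁺ (L ^ (fromℚ κ +ᴿ ε) /⁺ ∏⁺ X ^ fromℚ (1 /[ k -1])))
  product-bound divisor-bound X L δ 1≤X _ _ δ≤1 A A-ok (T , T-ok , δn≤T) {q} q<n = go (0 ℕ.<? (∏ℕ λ i → ∣ A i ∣)) {q} q<n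
    where
    go : Dec (0 < (∏ℕ λ i → ∣ A i ∣)) → fromℕ (∏ℕ λ i → ∣ A i ∣)
      ≤ᴿ value (C *⁺ δ ^ fromℚ (- κ) *⁺ (L ^ (fromℚ κ +ᴿ ε) /⁺ ∏⁺ X ^ fromℚ (1 /[ k -1])))
    go (yes 0<n) {q} q<n = reduction⇒bound X L δ (∏ℕ λ i → ∣ A i ∣) (λ i {q} → 1≤X i {q}) 0<n
      (reduction S K (s≤s z≤n) divisor-bound X L δ (λ i {q} → 1≤X i {q}) (λ {q} → δ≤1 {q}) A
        (λ i a∈ {q} → proj₁ (A-ok i a∈) {q}) T T-ok (λ {q} → δn≤T {q}) 0<n) {q} q<n
    -- Some `A i` is empty and has no least element, but then the left side is 0.
    go (no n≯0) {q} q<n = ≤0⇒≤⁺ (C *⁺ δ ^ fromℚ (- κ) *⁺ (L ^ (fromℚ κ +ᴿ ε) /⁺ ∏⁺ X ^ fromℚ (1 /[ k -1])))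
      (∏ℕ λ i → ∣ A i ∣) (ℕ.≮⇒≥ n≯0) {q} q<n

theorem1p5 : (k : ℕ) .{{_ : NonTrivial k}} (ε : ℝ) → 0ᴿ <ᴿ ε → ε <ᴿ 1ᴿ →
    Σ ℝ⁺ λ C →
    (X : Fin k → ℝ⁺) (L δ : ℝ⁺) →
    (∀ i → 1ᴿ ≤ᴿ value (X i)) → 1ᴿ ≤ᴿ value L → (∀ i → value (X i) ≤ᴿ value L) →
    value δ ≤ᴿ 1ᴿ →
    (A : Fin k → FiniteSet ℤ) →
    (∀ i {a} → a ∈ A i → value (X i) ≤ᴿ fromℤ a × fromℤ a ≤ᴿ 2ᴿ *ᴿ value (X i)) →
    (∃ λ (T : FiniteSet (Vec ℤ k)) →
    (∀ {a} → a ∈ T → (∀ i → lookup a i ∈ A i) × fromℤ (lcms a) ≤ᴿ value L) ×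
    value δ *ᴿ fromℕ (∏ℕ λ i → ∣ A i ∣) ≤ᴿ fromℕ ∣ T ∣) →
    fromℕ (∏ℕ λ i → ∣ A i ∣)
    ≤ᴿ value (C *⁺ δ ^ fromℚ (- (k /[ k -1]))
    *⁺ (L ^ (fromℚ (k /[ k -1]) +ᴿ ε) /⁺ ∏⁺ X ^ fromℚ (1 /[ k -1])))
theorem1p5 0 {{()}}
theorem1p5 1 {{()}}
theorem1p5 k@(suc (suc k₁)) ε 0<ε ε<1 =
  let s , 2η◃ε = 2/[1+s]◃ {ε} 0<ε
      -- With this exponent all divisor factors in `powers-bound` amount to one factor `K * ℓ`. Both
      -- `s` and `K`, hence the constant, depend on `k` and `ε` alone.
      K , 0<K , divisor-bound = bounded-divisor-bound (k * k * suc s)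
  in C k₁ s K ε ε<1 2η◃ε 0<K , product-bound k₁ s K ε ε<1 2η◃ε 0<K divisor-bound
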